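{- There exists a universal constant $d_0>0$ such that the following holds for all integers $d\geq d_0$. Let $G$ be a connected $n$-vertex $(1\pm 10^{ -10})d$-regular graph. Then $$|T_{\mathrm{unlabeled}}(G)|\geq e^{n/2000}.$$
   Context: For constants $d,\delta>0$, a graph $G$ is called $(1\pm\delta)d$-regular if every vertex degree of $G$ lies in the interval $[(1-\delta)d,(1+\delta)d]$. For an $n$-vertex graph $G$, $T_{\mathrm{unlabeled}}(G)$ denotes the set of unlabeled $n$-vertex trees contained in $G$ as spanning subgraphs, i.e. the set of isomorphism classes of spanning trees of $G$. -}

module Defs where

open import Data.Nat using (ℕ; zero; suc; _+_; _*_; _∸_; _^_; _≤_; _!)
open import Data.Bool using (Bool; true; false)
open import Data.Fin using (Fin; zero; suc; inject₁; fromℕ)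
open import Data.List using (List; []; _∷_; map; length)
open import Data.Nat.ListAction using (sum)
open import Data.List.Relation.Unary.AllPairs using (AllPairs)
open import Data.Product using (Σ; ∃; ∃-syntax; _×_)
open import Function.Bundles using (Inverse; _↔_)
open import Data.List.Membership.Propositional using (_∈_)
open import Function.Definitions using (Injective)
open import Relation.Binary.PropositionalEquality using (_≡_)
open import Relation.Nullary using (¬_)

record Graph (n : ℕ) : Set where
  field
    adj    : Fin n → Fin n → Bool
    sym    : ∀ u v → adj u v ≡ adj v u
    irrefl : ∀ v → adj v v ≡ false
open Graph public

allVertices : (n : ℕ) → List (Fin n)
allVertices zero    = []
allVertices (suc n) = zero ∷ map suc (allVertices n)

bit : Bool → ℕ
bit true  = 1
bit false = 0

degree : ∀ {n} → Graph n → Fin n → ℕ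
degree G u = sum (map (λ v → bit (adj G u v)) (allVertices _))

-- G is (1 ± 10^-10) d -regular, cleared of denominators:
-- (1 - 10^-10) d ≤ deg v ≤ (1 + 10^-10) d.
δ⁻¹ : ℕ
δ⁻¹ = 10 ^ 10

AlmostRegular : ∀ {n} → ℕ → Graph n → Set
AlmostRegular d G = ∀ v → ((δ⁻¹ ∸ 1) * d ≤ δ⁻¹ * degree G v)
                        × (δ⁻¹ * degree G v ≤ (δ⁻¹ + 1) * d)

data Reachable {n} (G : Graph n) : Fin n → Fin n → Set where
  here : ∀ {u} → Reachable G u u
  step : ∀ {u w v} → adj G u w ≡ true → Reachable G w v → Reachable G u v

Connected : ∀ {n} → Graph n → Set
Connected G = ∀ u v → Reachable G u v

HasCycle : ∀ {n} → Graph n → Set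
HasCycle {n} G = Σ ℕ λ k → Σ (Fin (3 + k) → Fin n) λ c →
    Injective _≡_ _≡_ c
  × (∀ (i : Fin (2 + k)) → adj G (c (inject₁ i)) (c (suc i)) ≡ true)
  × (adj G (c (fromℕ (2 + k))) (c zero) ≡ true)

IsTree : ∀ {n} → Graph n → Set
IsTree G = Connected G × ¬ HasCycle G

_⊆G_ : ∀ {n} → Graph n → Graph n → Set
H ⊆G G = ∀ u v → adj H u v ≡ true → adj G u v ≡ true

IsSpanningTree : ∀ {n} → Graph n → Graph n → Set
IsSpanningTree G H = (H ⊆G G) × IsTree H

Isomorphic : ∀ {n} → Graph n → Graph n → Set
Isomorphic {n} H H' = Σ (Fin n ↔ Fin n) λ σ →
  ∀ u v → adj H u v ≡ adj H' (Inverse.to σ u) (Inverse.to σ v)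

AtLeastUnlabeledSpanningTrees : ∀ {n} → Graph n → ℕ → Set
AtLeastUnlabeledSpanningTrees {n} G K =
  Σ (List (Graph n)) λ Ts →
      (length Ts ≡ K)
    × (∀ {H} → H ∈ Ts → IsSpanningTree G H)
    × AllPairs (λ H H' → ¬ Isomorphic H H') Ts

-- expScaled x m = m! * Σ_{k=0}^{m} x^k / k!   (a natural number)
expScaled : ℕ → ℕ → ℕ
expScaled x zero    = 1
expScaled x (suc m) = suc m * expScaled x m + x ^ suc m

-- e^x ≤ N  (x, N natural), via e^x = sup_m Σ_{k≤m} x^k/k!
ExpLe : ℕ → ℕ → Set
ExpLe x N = ∀ m → expScaled x m ≤ N * (m !)

{-# OPTIONS --safe #-}
module Submission where

-- Fix a small connected dominating set W of G (with a spanning tree on it) and pack vertex-disjoint combs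
-- (paths with one pendant tooth per vertex) of length L into the rest of G; the combs cover a fixed
-- proportion of the vertices. Hang every comb on W by its first vertex, and every remaining vertex on W
-- directly. Each tooth may be attached either to its spine vertex or to W, which gives 2^Ω(n) trees.
-- An isomorphism from one of these trees to another is determined on W and on the spines by few choices:
-- the image of the root, and the image of each further vertex of W and of each first vertex of a comb among
-- the at most 2d neighbours of an image already known; along a spine the image of the next vertex is the
-- only non-leaf continuation. The teeth are then read off as leaves. With L of order log d there are O(n/L)
-- such choices, hence isomorphism classes in the family have size at most 2^εn.

-- The length `L` of the combs is squeezed from two sides. Naming a comb costs the image of its
-- first vertex, about log d bits, and gains `L` - 1 free bits, so `L` must be a large multiple of
-- log d. Packing wants `L` far below d: a vertex at which the greedy search gets stuck has at most
-- 2L available neighbours, so the discarded vertices span few edges and send most of their edges,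
-- at least d/2 each, to W and to the combs, whose vertices absorb at most 2d each. As W is small,
-- the combs then cover a fixed proportion of the graph. The choice is `L` = 20000 κ, where κ is the
-- integer part of log₂ d, with d so large that L² ≤ d. The same `L` is the threshold in the greedy
-- choice of W and gives |W| = O(n/L). Regularity enters as d/2 ≤ deg ≤ 2d. The rate n/2000 comes
-- out as follows: 2^m pairwise non-isomorphic trees with 1000 m ≥ n are enough, because (2^m)^2000
-- ≥ 4^n ≥ e^n.

open import Defs hiding (sym)
open import Data.Bool using (Bool; true; false; if_then_else_)
import Data.Bool as Bool
open import Data.Empty using (⊥-elim)
open import Data.Fin using (Fin; zero; suc; toℕ; inject₁; fromℕ; _≟_)
open import Data.Fin.Properties using (any?; suc-injective; toℕ-inject₁)
open import Data.Fin.Relation.Unary.Top using (view; ‵fromℕ; ‵inject₁)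
open import Data.List using (List; []; _∷_; map; filter; length; _++_; concatMap; take; allFin)
import Data.List as List
import Data.List.Membership.DecPropositional as DecMembership
open import Data.List.Membership.Propositional using (_∈_; _∉_; find; lose)
open import Data.List.Membership.Propositional.Properties
  using (∈-map⁺; ∈-map⁻; ∈-concatMap⁺; ∈-filter⁺; ∈-filter⁻; ∈-allFin; ∈-lookup; ∈-∃++; ∈-++⁺ˡ; ∈-++⁺ʳ; ∈-++⁻)
open import Data.List.Properties
  using (length-++; length-map; length-tabulate; length-take; map-++; ++-assoc; concatMap-++; filter-++)
open import Data.List.Relation.Binary.Permutation.Propositional
  using (_↭_; prep; swap; ↭-refl; ↭-sym; ↭-trans; ↭-reflexive; ↭⇒↭ₛ)
import Data.List.Relation.Binary.Permutation.Propositional.Properties as Perm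
import Data.List.Relation.Binary.Permutation.Setoid.Properties as PermSetoid
import Data.List.Relation.Unary.All as All
open import Data.List.Relation.Unary.AllPairs using (AllPairs; []; _∷_)
import Data.List.Relation.Unary.AllPairs as AllPairs
import Data.List.Relation.Unary.AllPairs.Properties as AllPairs
open import Data.List.Relation.Unary.Any using (Any; here; there)
import Data.List.Relation.Unary.Any as Any
import Data.List.Relation.Unary.Any.Properties as Any
open import Data.List.Relation.Unary.Unique.Propositional using (Unique)
open import Data.List.Relation.Unary.Unique.Propositional.Properties using (filter⁺; map⁺; ++⁺)
open import Data.Maybe using (Maybe; just; nothing; is-just)
open import Data.Maybe.Properties using (just-injective)
open import Data.Nat hiding (_≟_)
open import Data.Nat.DivMod using (m≡m%n+[m/n]*n; m%n<n)
open import Data.Nat.ListAction using (sum)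
open import Data.Nat.ListAction.Properties using (sum-++; sum-↭)
open import Data.Nat.Properties hiding (_≟_; suc-injective)
open import Data.Nat.Tactic.RingSolver using (solve-∀)
open import Data.Product using (Σ; ∃; ∃₂; _×_; _,_; proj₁; proj₂)
open import Data.Sum using (_⊎_; inj₁; inj₂)
import Data.Sum as Sum
open import Data.Vec using (Vec; []; _∷_; tabulate; lookup)
open import Data.Vec.Properties using (≡-dec; ∷-injectiveʳ; tabulate-cong; tabulate∘lookup)
open import Function using (_∘_; const; id; case_of_)
open import Function.Bundles using (Inverse; mk⇔; mk↔ₛ′)
open import Relation.Binary using (DecidableEquality)
open import Relation.Binary.PropositionalEquality hiding ([_])
open import Relation.Nullary
open import Relation.Nullary.Decidable using (does-⇔; dec-true; dec-false)

-- Exponential sums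

rising : ℕ → ℕ → ℕ
rising N zero    = 1
rising N (suc m) = N * rising (suc N) m

rising-last : ∀ N m → rising N (suc m) ≡ (N + m) * rising N m
rising-last N zero    = cong (_* 1) (sym (+-identityʳ N))
rising-last N (suc m) = trans (cong (N *_) (rising-last (suc N) m)) (lemma N m (rising (suc N) m))
  where
  lemma : ∀ N m r → N * ((suc N + m) * r) ≡ (N + suc m) * (N * r)
  lemma = solve-∀

rising-suc : ∀ N m → rising (suc N) (suc m) ≡ rising N (suc m) + suc m * rising (suc N) m
rising-suc N m = trans (rising-last (suc N) m) (lemma N m (rising (suc N) m))
  where
  lemma : ∀ N m r → (suc N + m) * r ≡ N * r + suc m * r
  lemma = solve-∀

^*^≤rising : ∀ m {a b N} → a * b ≤ N → a ^ m * b ^ m ≤ rising N m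
^*^≤rising zero            _    = ≤-refl
^*^≤rising (suc m) {a} {b} ab≤N = ≤-trans
  (≤-reflexive ([m*n]*[o*p]≡[m*o]*[n*p] a (a ^ m) b (b ^ m)))
  (*-mono-≤ ab≤N (^*^≤rising m (m≤n⇒m≤1+n ab≤N)))

-- This is 2^m m! times the sum over k ≤ m of C(N + k - 1, k) 2^(-k), a truncation of the binomial
-- series of (1 - 1/2)^(-N) = 2^N. With N = 2x it dominates the exponential sum term by term, since
-- (2x)^k is at most `rising (2 * x) k`.
negBin : ℕ → ℕ → ℕ
negBin N zero    = 1
negBin N (suc m) = 2 * suc m * negBin N m + rising N (suc m)

-- Pascal's rule summed over k: the identity (1 - z) (1 - z)^(-N-1) = (1 - z)^(-N) for truncated
-- series at z = 1/2.
negBin-suc : ∀ N m → negBin (suc N) (suc m) ≡ negBin N (suc m) + suc m * negBin (suc N) m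
negBin-suc N zero = lemma N
  where
  lemma : ∀ N → 2 * 1 * 1 + suc N * 1 ≡ (2 * 1 * 1 + N * 1) + 1 * 1
  lemma = solve-∀
negBin-suc N (suc m) =
  trans (cong₂ (λ a b → 2 * suc (suc m) * a + b) (negBin-suc N m) (rising-suc N (suc m)))
        (lemma m (negBin N (suc m)) (negBin (suc N) m) (rising N (suc (suc m))) (rising (suc N) (suc m)))
  where
  lemma : ∀ m a b c r →
    2 * suc (suc m) * (a + suc m * b) + (c + suc (suc m) * r)
      ≡ (2 * suc (suc m) * a + c) + suc (suc m) * (2 * suc m * b + r)
  lemma = solve-∀

-- Twice the increment in `negBin-suc` is the left-hand side without its last summand, so the
-- increment is at most half of it.
negBin-double : ∀ N m → negBin (suc N) (suc m) ≤ 2 * negBin N (suc m)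
negBin-double N m = +-cancelʳ-≤ g g (2 * a) (begin
  g + g                                    ≡⟨ cong (λ z → z + z) (negBin-suc N m) ⟩
  (a + suc m * b) + (a + suc m * b)        ≡⟨ lemma a m b ⟩
  2 * a + 2 * suc m * b                    ≤⟨ +-monoʳ-≤ (2 * a) (m≤m+n _ _) ⟩
  2 * a + g                                ∎)
  where
  open ≤-Reasoning
  a = negBin N (suc m)
  b = negBin (suc N) m
  g = negBin (suc N) (suc m)
  lemma : ∀ a m b → (a + suc m * b) + (a + suc m * b) ≡ 2 * a + 2 * suc m * b
  lemma = solve-∀

negBin-bound : ∀ N m → negBin N m ≤ 2 ^ N * (2 ^ m * m !)
negBin-bound N       zero    = ≤-trans (m^n>0 2 N) (≤-reflexive (sym (*-identityʳ (2 ^ N))))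
negBin-bound zero    (suc m) = begin
  2 * suc m * negBin 0 m + 0         ≡⟨ +-identityʳ _ ⟩
  2 * suc m * negBin 0 m             ≤⟨ *-monoʳ-≤ (2 * suc m) (negBin-bound 0 m) ⟩
  2 * suc m * (1 * (2 ^ m * m !))    ≡⟨ lemma m (2 ^ m) (m !) ⟩
  1 * (2 ^ suc m * (suc m) !)        ∎
  where
  open ≤-Reasoning
  lemma : ∀ m p f → 2 * suc m * (1 * (p * f)) ≡ 1 * ((2 * p) * (suc m * f))
  lemma = solve-∀
negBin-bound (suc N) (suc m) = begin
  negBin (suc N) (suc m)                        ≤⟨ negBin-double N m ⟩
  2 * negBin N (suc m)                          ≤⟨ *-monoʳ-≤ 2 (negBin-bound N (suc m)) ⟩
  2 * (2 ^ N * (2 ^ suc m * (suc m) !))         ≡⟨ sym (*-assoc 2 (2 ^ N) _) ⟩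
  2 ^ suc N * (2 ^ suc m * (suc m) !)           ∎
  where open ≤-Reasoning

expScaled≤negBin : ∀ x m → 2 ^ m * expScaled x m ≤ negBin (2 * x) m
expScaled≤negBin x zero    = ≤-refl
expScaled≤negBin x (suc m) = begin
  2 ^ suc m * (suc m * e + x ^ suc m)          ≡⟨ lemma (2 ^ m) (suc m) e (x ^ suc m) ⟩
  2 * suc m * (2 ^ m * e) + 2 ^ suc m * x ^ suc m
    ≤⟨ +-mono-≤ (*-monoʳ-≤ (2 * suc m) (expScaled≤negBin x m))
                (^*^≤rising (suc m) {2} {x} ≤-refl) ⟩
  negBin (2 * x) (suc m)                       ∎
  where
  open ≤-Reasoning
  e = expScaled x m
  lemma : ∀ p s e y → (2 * p) * (s * e + y) ≡ 2 * s * (p * e) + (2 * p) * y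
  lemma = solve-∀

-- Replaces e by a power of two, so that everything later is a count of bits.
ExpLe-4^ : ∀ x → ExpLe x (4 ^ x)
ExpLe-4^ x m = *-cancelˡ-≤ (2 ^ m) {{m^n≢0 2 m}} (begin
  2 ^ m * expScaled x m          ≤⟨ expScaled≤negBin x m ⟩
  negBin (2 * x) m               ≤⟨ negBin-bound (2 * x) m ⟩
  2 ^ (2 * x) * (2 ^ m * m !)    ≡⟨ cong (_* (2 ^ m * m !)) (sym (^-*-assoc 2 2 x)) ⟩
  4 ^ x * (2 ^ m * m !)          ≡⟨ lemma (4 ^ x) (2 ^ m) (m !) ⟩
  2 ^ m * (4 ^ x * m !)          ∎)
  where
  open ≤-Reasoning
  lemma : ∀ a b c → a * (b * c) ≡ b * (a * c)
  lemma = solve-∀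

-- Rooted trees as graphs

dec-true⁻ : ∀ {a} {A : Set a} (a? : Dec A) → does a? ≡ true → A
dec-true⁻ (yes a) _ = a

argmax : ∀ {m} (f : Fin (suc m) → ℕ) → ∃ λ i → ∀ j → f j ≤ f i
argmax {zero}  f = zero , λ { zero → ≤-refl }
argmax {suc m} f with argmax (λ i → f (suc i))
... | i , max with ≤-total (f zero) (f (suc i))
...   | inj₁ le = suc i , λ { zero → le ; (suc j) → max j }
...   | inj₂ ge = zero  , λ { zero → ≤-refl ; (suc j) → ≤-trans (max j) ge }

cycle-neighbours : ∀ {n} (G : Graph n) {k} (c : Fin (3 + k) → Fin n) →
  (∀ (i : Fin (2 + k)) → adj G (c (inject₁ i)) (c (suc i)) ≡ true) →
  adj G (c (fromℕ (2 + k))) (c zero) ≡ true →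
  ∀ i → ∃₂ λ a b → a ≢ b × adj G (c i) (c a) ≡ true × adj G (c i) (c b) ≡ true
cycle-neighbours G {k} c link close zero =
  suc zero , fromℕ (2 + k) , (λ ()) , link zero , trans (Graph.sym G _ _) close
cycle-neighbours G {k} c link close (suc j) with view j
... | ‵fromℕ = inject₁ j , zero , (λ ()) , trans (Graph.sym G _ _) (link j) , close
... | ‵inject₁ i = inject₁ j , suc (suc i) , a≢b , trans (Graph.sym G _ _) (link j) , link (suc i)
  where
  a≢b : inject₁ (inject₁ i) ≢ suc (suc i)
  a≢b eq = <⇒≢ (m<n⇒m<1+n (n<1+n (toℕ i)))
    (trans (sym (trans (toℕ-inject₁ (inject₁ i)) (toℕ-inject₁ i))) (cong toℕ eq))

-- A parent function with a rank that drops along it carries both halves of `IsTree`: descent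
-- reaches the root from anywhere, and a cycle would have no vertex of maximal rank.
record RootedTree (n : ℕ) : Set where
  field
    root     : Fin n
    par      : Fin n → Fin n
    rank     : Fin n → ℕ
    par-root : par root ≡ root
    rank-par : ∀ {v} → v ≢ root → rank (par v) < rank v

  Edge : Fin n → Fin n → Set
  Edge u v = u ≢ v × (par u ≡ v ⊎ par v ≡ u)

  edge? : ∀ u v → Dec (Edge u v)
  edge? u v = ¬? (u ≟ v) ×-dec (par u ≟ v ⊎-dec par v ≟ u)

  Edge-sym : ∀ {u v} → Edge u v → Edge v u
  Edge-sym (u≢v , e) = ≢-sym u≢v , Sum.swap e

  graph : Graph n
  graph .adj u v       = does (edge? u v)
  graph .Graph.sym u v = does-⇔ (mk⇔ Edge-sym Edge-sym) (edge? u v) (edge? v u)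
  graph .irrefl v      = dec-false (edge? v v) λ (v≢v , _) → v≢v refl

  Edge⇒adj : ∀ {u v} → Edge u v → adj graph u v ≡ true
  Edge⇒adj = dec-true (edge? _ _)

  adj⇒Edge : ∀ {u v} → adj graph u v ≡ true → Edge u v
  adj⇒Edge = dec-true⁻ (edge? _ _)

  par≢ : ∀ {v} → v ≢ root → v ≢ par v
  par≢ v≢ρ v≡par = <-irrefl (cong rank (sym v≡par)) (rank-par v≢ρ)

  par-edge : ∀ {v} → v ≢ root → Edge v (par v)
  par-edge v≢ρ = par≢ v≢ρ , inj₁ refl

  rank-mono : ∀ {u v} → par u ≡ v → u ≢ v → rank v < rank u
  rank-mono {u} refl u≢par with u ≟ root
  ... | yes refl = ⊥-elim (u≢par (sym par-root))
  ... | no u≢ρ   = rank-par u≢ρ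

  ⊆G-intro : (G : Graph n) → (∀ {v} → v ≢ root → adj G v (par v) ≡ true) → graph ⊆G G
  ⊆G-intro G h u v e with adj⇒Edge e
  ... | u≢v , inj₁ refl = h λ { refl → u≢v (sym par-root) }
  ... | u≢v , inj₂ refl = trans (Graph.sym G _ _) (h λ { refl → u≢v par-root })

  private
    reach-trans : ∀ {u v w} → Reachable graph u v → Reachable graph v w → Reachable graph u w
    reach-trans here       r = r
    reach-trans (step e s) r = step e (reach-trans s r)

    reach-root : ∀ m v → rank v < m → Reachable graph v root × Reachable graph root v
    reach-root (suc m) v (s≤s le) with v ≟ root
    ... | yes refl = here , here
    ... | no v≢ρ with reach-root m (par v) (≤-trans (rank-par v≢ρ) le)
    ...   | up , down = step (Edge⇒adj (par-edge v≢ρ)) up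
                      , reach-trans down (step (Edge⇒adj (Edge-sym (par-edge v≢ρ))) here)

  connected : Connected graph
  connected u v = reach-trans (proj₁ (reach-root _ u ≤-refl)) (proj₂ (reach-root _ v ≤-refl))

  -- Both neighbours of a vertex of maximal rank on a cycle would be its parent.
  acyclic : ¬ HasCycle graph
  acyclic (k , c , inj , link , close) with argmax (λ i → rank (c i))
  ... | i , max with cycle-neighbours graph c link close i
  ... | a , b , a≢b , ea , eb = a≢b (inj (trans (sym (to-par a ea)) (to-par b eb)))
    where
    to-par : ∀ j → adj graph (c i) (c j) ≡ true → par (c i) ≡ c j
    to-par j e with adj⇒Edge e
    ... | _   , inj₁ p = p
    ... | i≢j , inj₂ p = ⊥-elim (<⇒≱ (rank-mono p (≢-sym i≢j)) (max j))

  isTree : IsTree graph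
  isTree = connected , acyclic

-- Locating a tree inside an isomorphic copy

∈-allVertices : ∀ {n} (v : Fin n) → v ∈ allVertices n
∈-allVertices zero    = here refl
∈-allVertices (suc v) = there (∈-map⁺ suc (∈-allVertices v))

length-concatMap-≤ : ∀ {a b} {A : Set a} {B : Set b} (f : A → List B) k →
  (∀ x → length (f x) ≤ k) → ∀ xs → length (concatMap f xs) ≤ length xs * k
length-concatMap-≤ f k h []       = z≤n
length-concatMap-≤ f k h (x ∷ xs) = ≤-trans
  (≤-reflexive (length-++ (f x)))
  (+-mono-≤ (h x) (length-concatMap-≤ f k h xs))

neighbours : ∀ {n} → Graph n → Fin n → List (Fin n)
neighbours G u = filter (λ w → adj G u w Bool.≟ true) (allVertices _)

length-neighbours : ∀ {n} (G : Graph n) u → length (neighbours G u) ≡ degree G u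
length-neighbours G u = go (allVertices _)
  where
  go : ∀ vs → length (filter (λ w → adj G u w Bool.≟ true) vs) ≡ sum (map (bit ∘ adj G u) vs)
  go []       = refl
  go (v ∷ vs) with adj G u v
  ... | true  = cong suc (go vs)
  ... | false = go vs

module _ {n} (H : Graph n) where

  -- For a neighbour u of p this says that u is not a leaf. It is phrased by adjacency alone, so
  -- that it transfers along isomorphisms together with the notions built on it.
  HasOther : Fin n → Fin n → Set
  HasOther p u = ∃ λ a → a ≢ p × adj H u a ≡ true

  DeepChild FlatChild : Fin n → Fin n → Fin n → Set
  DeepChild g p u = adj H p u ≡ true × u ≢ g × HasOther p u
  FlatChild g p u = adj H p u ≡ true × u ≢ g × ¬ HasOther p u

  hasOther? : ∀ p u → Dec (HasOther p u)
  hasOther? p u = any? λ a → ¬? (a ≟ p) ×-dec adj H u a Bool.≟ true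

  deepChild? : ∀ g p → Dec (∃ (DeepChild g p))
  deepChild? g p = any? λ u → adj H p u Bool.≟ true ×-dec ¬? (u ≟ g) ×-dec hasOther? p u

  flatChild? : ∀ g p → Dec (∃ (FlatChild g p))
  flatChild? g p = any? λ u → adj H p u Bool.≟ true ×-dec ¬? (u ≟ g) ×-dec ¬? (hasOther? p u)

  -- The value p is a junk default.
  next : Fin n → Fin n → Fin n
  next g p with deepChild? g p
  ... | yes (u , _) = u
  ... | no _        = p

  readBit : Fin n → Fin n → Bool
  readBit g p = does (flatChild? g p)

-- An instruction locates its first vertex in a tree from the positions of its other vertices:
-- as an arbitrary neighbour of p, or as the only deep child of p when p is entered from g.
data Instr (n : ℕ) : Set where
  free   : (v p : Fin n) → Instr n
  forced : (v p g : Fin n) → Instr n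

target : ∀ {n} → Instr n → Fin n
target (free v _)     = v
target (forced v _ _) = v

#free : ∀ {n} → List (Instr n) → ℕ
#free []                  = 0
#free (free _ _     ∷ is) = suc (#free is)
#free (forced _ _ _ ∷ is) = #free is

_[_↦_] : ∀ {n} {A : Set} → (Fin n → A) → Fin n → A → Fin n → A
(f [ v ↦ w ]) u with u ≟ v
... | yes _ = w
... | no _  = f u

-- Programs are listed with the last instruction first.
run : ∀ {n} → Graph n → List (Instr n) → List (Fin n → Fin n)
-- The guess for the root is a constant function; a valid program only reads it at vertices already
-- named.
run H []                  = map const (allFin _)
run H (free v p ∷ is)     = concatMap (λ f → map (λ w → f [ v ↦ w ]) (neighbours H (f p))) (run H is)
run H (forced v p g ∷ is) = map (λ f → f [ v ↦ next H (f g) (f p) ]) (run H is)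

length-run : ∀ {n} (H : Graph n) Δ → (∀ u → degree H u ≤ Δ) →
  ∀ is → length (run H is) ≤ n * Δ ^ #free is
length-run {n} H Δ deg≤ [] = ≤-reflexive
  (trans (length-map const (allFin n)) (trans (length-tabulate {n = n} _) (sym (*-identityʳ n))))
length-run {n} H Δ deg≤ (free v p ∷ is) = begin
  length (run H (free v p ∷ is))   ≤⟨ length-concatMap-≤ _ Δ branch (run H is) ⟩
  length (run H is) * Δ            ≤⟨ *-monoˡ-≤ Δ (length-run H Δ deg≤ is) ⟩
  n * Δ ^ #free is * Δ             ≡⟨ *-assoc n _ Δ ⟩
  n * (Δ ^ #free is * Δ)           ≡⟨ cong (n *_) (*-comm _ Δ) ⟩
  n * Δ ^ suc (#free is)           ∎
  where
  open ≤-Reasoning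
  branch : ∀ f → length (map (λ w → f [ v ↦ w ]) (neighbours H (f p))) ≤ Δ
  branch f = ≤-trans (≤-reflexive (trans (length-map _ (neighbours H (f p))) (length-neighbours H (f p)))) (deg≤ (f p))
length-run H Δ deg≤ (forced v p g ∷ is) =
  ≤-trans (≤-reflexive (length-map _ (run H is))) (length-run H Δ deg≤ is)

Known : ∀ {n} → Fin n → List (Instr n) → Fin n → Set
Known ρ is v = v ≡ ρ ⊎ v ∈ map target is

-- `H` is the tree that the program describes, while it is run in an isomorphic copy. Uniqueness in
-- `forced` is what lets `next` find the image in the copy without a guess.
data Valid {n} (H : Graph n) (ρ : Fin n) : List (Instr n) → Set where
  []     : Valid H ρ []
  free   : ∀ {v p is} → Known ρ is p → adj H p v ≡ true → Valid H ρ is → Valid H ρ (free v p ∷ is)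
  forced : ∀ {v p g is} → Known ρ is p → Known ρ is g → DeepChild H g p v →
           (∀ {u} → DeepChild H g p u → u ≡ v) → Valid H ρ is → Valid H ρ (forced v p g ∷ is)

module Decoding {n} (H H' : Graph n) (iso : Isomorphic H H') where

  private
    module σ = Inverse (proj₁ iso)

  φ ψ : Fin n → Fin n
  φ = σ.to
  ψ = σ.from

  φψ : ∀ v → φ (ψ v) ≡ v
  φψ v = σ.inverseˡ refl

  ψφ : ∀ v → ψ (φ v) ≡ v
  ψφ v = σ.inverseʳ refl

  ψ-injective : ∀ {u v} → ψ u ≡ ψ v → u ≡ v
  ψ-injective {u} {v} eq = trans (sym (φψ u)) (trans (cong φ eq) (φψ v))

  adj-φ : ∀ u v → adj H u v ≡ adj H' (φ u) (φ v)
  adj-φ = proj₂ iso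

  adj-ψ : ∀ u v → adj H' u v ≡ adj H (ψ u) (ψ v)
  adj-ψ u v = sym (trans (adj-φ (ψ u) (ψ v)) (cong₂ (adj H') (φψ u) (φψ v)))

  other-ψ : ∀ {p u} → HasOther H' p u → HasOther H (ψ p) (ψ u)
  other-ψ (a , a≢p , e) = ψ a , a≢p ∘ ψ-injective , trans (sym (adj-ψ _ a)) e

  other-φ : ∀ {p u} → HasOther H (ψ p) u → HasOther H' p (φ u)
  other-φ (a , a≢p , e) =
    φ a , (λ eq → a≢p (trans (sym (ψφ a)) (cong ψ eq))) , trans (sym (adj-φ _ a)) e

  adj-φ⁺ : ∀ {p u} → adj H (ψ p) u ≡ true → adj H' p (φ u) ≡ true
  adj-φ⁺ {p} {u} e = trans (cong (λ q → adj H' q (φ u)) (sym (φψ p))) (trans (sym (adj-φ _ u)) e)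

  deep-ψ : ∀ {g p u} → DeepChild H' g p u → DeepChild H (ψ g) (ψ p) (ψ u)
  deep-ψ (e , u≢g , o) = trans (sym (adj-ψ _ _)) e , u≢g ∘ ψ-injective , other-ψ o

  deep-φ : ∀ {g p u} → DeepChild H (ψ g) (ψ p) u → DeepChild H' g p (φ u)
  deep-φ (e , u≢g , o) =
    adj-φ⁺ e , (λ eq → u≢g (trans (sym (ψφ _)) (cong ψ eq))) , other-φ o

  flat-ψ : ∀ {g p u} → FlatChild H' g p u → FlatChild H (ψ g) (ψ p) (ψ u)
  flat-ψ {g} {p} {u} (e , u≢g , ¬o) = trans (sym (adj-ψ _ _)) e , u≢g ∘ ψ-injective ,
    λ o → ¬o (subst (HasOther H' p) (φψ u) (other-φ o))

  flat-φ : ∀ {g p u} → FlatChild H (ψ g) (ψ p) u → FlatChild H' g p (φ u)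
  flat-φ {g} {p} {u} (e , u≢g , ¬o) =
    adj-φ⁺ e , (λ eq → u≢g (trans (sym (ψφ _)) (cong ψ eq))) ,
    λ o → ¬o (subst (HasOther H (ψ p)) (ψφ u) (other-ψ o))

  next-ψ : ∀ {g p v} → DeepChild H' g p v → (∀ {u} → DeepChild H' g p u → u ≡ v) →
    next H (ψ g) (ψ p) ≡ ψ v
  next-ψ {g} {p} d unique with deepChild? H (ψ g) (ψ p)
  ... | yes (u , du) = trans (sym (ψφ u)) (cong ψ (unique (deep-φ du)))
  ... | no ¬d        = ⊥-elim (¬d (_ , deep-ψ d))

  readBit-ψ : ∀ g p → readBit H' g p ≡ readBit H (ψ g) (ψ p)
  readBit-ψ g p = does-⇔ (mk⇔ (λ (u , f) → ψ u , flat-ψ f) (λ (u , f) → φ u , flat-φ f))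
    (flatChild? H' g p) (flatChild? H (ψ g) (ψ p))

  update-agrees : ∀ {f : Fin n → Fin n} {v w} → w ≡ ψ v → (f [ v ↦ w ]) v ≡ ψ v
  update-agrees {v = v} eq with v ≟ v
  ... | yes _  = eq
  ... | no v≢v = ⊥-elim (v≢v refl)

  -- Naming a vertex a second time is harmless, because the new value is again its image under `ψ`.
  update-keeps : ∀ {f : Fin n → Fin n} {v w u} → w ≡ ψ v → f u ≡ ψ u → (f [ v ↦ w ]) u ≡ ψ u
  update-keeps {v = v} {u = u} eq h with u ≟ v
  ... | yes refl = eq
  ... | no _     = h

  update-known : ∀ {ρ} i {is} {f : Fin n → Fin n} {w} → w ≡ ψ (target i) →
    (∀ {v} → Known ρ is v → f v ≡ ψ v) → ∀ {v} → Known ρ (i ∷ is) v → (f [ target i ↦ w ]) v ≡ ψ v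
  update-known i eq h (inj₁ refl)         = update-keeps eq (h (inj₁ refl))
  update-known i eq h (inj₂ (here refl))  = update-agrees eq
  update-known i eq h (inj₂ (there v∈is)) = update-keeps eq (h (inj₂ v∈is))

  -- The program is valid in `H'` but is run in `H`. Among the branches there is one that follows
  -- `ψ` at the root and at every free choice; at the forced ones `next-ψ` leaves no alternative.
  run-complete : ∀ {ρ is} → Valid H' ρ is → ∃ λ f → f ∈ run H is × (∀ {v} → Known ρ is v → f v ≡ ψ v)
  run-complete {ρ} [] = const (ψ ρ) , ∈-map⁺ const (∈-allFin (ψ ρ)) , λ { (inj₁ refl) → refl }
  run-complete (free {v} {p} {is} kp e valid) with run-complete valid
  ... | f , f∈ , agree = f [ v ↦ ψ v ] , mem , update-known (free v p) refl agree
    where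
    mem : f [ v ↦ ψ v ] ∈ run H (free v p ∷ is)
    mem = ∈-concatMap⁺ _ (Any.map (λ { refl → ∈-map⁺ _ (∈-filter⁺ _ (∈-allVertices (ψ v))
            (trans (cong (λ q → adj H q (ψ v)) (agree kp)) (trans (sym (adj-ψ p v)) e))) }) f∈)
  run-complete (forced {v} {p} {g} kp kg d unique valid) with run-complete valid
  ... | f , f∈ , agree = f [ v ↦ next H (f g) (f p) ] , ∈-map⁺ _ f∈ ,
    update-known (forced v p g) (trans (cong₂ (next H) (agree kg) (agree kp)) (next-ψ d unique)) agree

-- The family of spanning trees

-- One step of a comb: entry is the parent of spine, and kid the next spine vertex. The last cell of a comb
-- has no kid, and its tooth is always attached to its spine, so that every spine vertex is a non-leaf.
record Cell (n : ℕ) : Set where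
  constructor cell
  field
    spine tooth entry : Fin n
    kid               : Maybe (Fin n)
    level             : ℕ
open Cell public

hasKid? : ∀ {n} (c : Cell n) → Dec (is-just (kid c) ≡ true)
hasKid? c = is-just (kid c) Bool.≟ true

-- What all trees of the family share; a tree is determined by this and one bit per spine vertex
-- with a kid. `par₀` is the tree on W and, outside W, a default attachment to W. The numbers
-- `rank₀`, `B`, `level` and `L` supply the ranks which show that all these parent functions give
-- trees.
record Scaffold {n} (G : Graph n) : Set where
  field
    root  : Fin n
    W     : List (Fin n)
    par₀  : Fin n → Fin n
    rank₀ : Fin n → ℕ
    B L   : ℕ
    cells : List (Cell n)

    root∈W    : root ∈ W
    par₀-root : par₀ root ≡ root
    par₀-∈W   : ∀ v → par₀ v ∈ W
    par₀-adj  : ∀ {v} → v ≢ root → adj G v (par₀ v) ≡ true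
    rank₀-<   : ∀ {v} → v ∈ W → v ≢ root → rank₀ (par₀ v) < rank₀ v
    rank₀-<B  : ∀ {v} → v ∈ W → rank₀ v < B

    cells-unique    : Unique cells
    spine-injective : ∀ {c c′} → c ∈ cells → c′ ∈ cells → spine c ≡ spine c′ → c ≡ c′
    tooth-injective : ∀ {c c′} → c ∈ cells → c′ ∈ cells → tooth c ≡ tooth c′ → c ≡ c′
    spine≢tooth     : ∀ {c c′} → c ∈ cells → c′ ∈ cells → spine c ≢ tooth c′
    spine∉W         : ∀ {c} → c ∈ cells → spine c ∉ W
    tooth∉W         : ∀ {c} → c ∈ cells → tooth c ∉ W
    adj-entry       : ∀ {c} → c ∈ cells → adj G (spine c) (entry c) ≡ true
    adj-tooth       : ∀ {c} → c ∈ cells → adj G (tooth c) (spine c) ≡ true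
    level-<L        : ∀ {c} → c ∈ cells → level c < L
    entry-from      : ∀ {c} → c ∈ cells → entry c ∈ W ⊎
      ∃ λ c′ → c′ ∈ cells × spine c′ ≡ entry c × kid c′ ≡ just (spine c) × level c′ < level c
    kid-cell        : ∀ {c w} → c ∈ cells → kid c ≡ just w →
      ∃ λ c′ → c′ ∈ cells × spine c′ ≡ w × entry c′ ≡ spine c

  open DecMembership (_≟_ {n}) using (_∈?_)

  Location : Fin n → Set
  Location u = (∃ λ c → c ∈ cells × spine c ≡ u) ⊎ (∃ λ c → c ∈ cells × tooth c ≡ u)
    ⊎ (∀ {c} → c ∈ cells → spine c ≢ u × tooth c ≢ u)

  locate : ∀ u → Location u
  locate u with Any.any? (λ c → spine c ≟ u) cells | Any.any? (λ c → tooth c ≟ u) cells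
  ... | yes s | _     = inj₁ (find s)
  ... | no ¬s | yes t = inj₂ (inj₁ (find t))
  ... | no ¬s | no ¬t = inj₂ (inj₂ λ c∈ →
    (λ { refl → ¬s (Any.map (λ { refl → refl }) c∈) }) ,
    (λ { refl → ¬t (Any.map (λ { refl → refl }) c∈) }))

  toothParent : (Fin n → Bool) → Cell n → Fin n
  toothParent x c with kid c
  ... | nothing = spine c
  ... | just _  = if x (spine c) then spine c else par₀ (tooth c)

  toothParent-∈W : ∀ x c → toothParent x c ≡ spine c ⊎ toothParent x c ∈ W
  toothParent-∈W x c with kid c
  ... | nothing = inj₁ refl
  ... | just _ with x (spine c)
  ...   | true  = inj₁ refl
  ...   | false = inj₂ (par₀-∈W _)

  par : (Fin n → Bool) → Fin n → Fin n
  par x u with locate u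
  ... | inj₁ (c , _)        = entry c
  ... | inj₂ (inj₁ (c , _)) = toothParent x c
  ... | inj₂ (inj₂ _)       = par₀ u

  -- Three layers: W below `B`, spines from `B` upwards by level, teeth and all remaining vertices
  -- at `B + L`. The bits do not enter, since a tooth lies above both of its possible parents.
  rank : Fin n → ℕ
  rank u with locate u
  ... | inj₁ (c , _)  = B + level c
  ... | inj₂ (inj₁ _) = B + L
  ... | inj₂ (inj₂ _) with u ∈? W
  ...   | yes _ = rank₀ u
  ...   | no _  = B + L

  par-spine : ∀ x {c} → c ∈ cells → par x (spine c) ≡ entry c
  par-spine x {c} c∈ with locate (spine c)
  ... | inj₁ (c′ , c′∈ , eq)        = cong entry (spine-injective c′∈ c∈ eq)
  ... | inj₂ (inj₁ (c′ , c′∈ , eq)) = ⊥-elim (spine≢tooth c∈ c′∈ (sym eq))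
  ... | inj₂ (inj₂ neither)         = ⊥-elim (proj₁ (neither c∈) refl)

  par-tooth : ∀ x {c} → c ∈ cells → par x (tooth c) ≡ toothParent x c
  par-tooth x {c} c∈ with locate (tooth c)
  ... | inj₁ (c′ , c′∈ , eq)        = ⊥-elim (spine≢tooth c′∈ c∈ eq)
  ... | inj₂ (inj₁ (c′ , c′∈ , eq)) = cong (toothParent x) (tooth-injective c′∈ c∈ eq)
  ... | inj₂ (inj₂ neither)         = ⊥-elim (proj₂ (neither c∈) refl)

  par-W : ∀ x {w} → w ∈ W → par x w ≡ par₀ w
  par-W x {w} w∈ with locate w
  ... | inj₁ (c , c∈ , refl)        = ⊥-elim (spine∉W c∈ w∈)
  ... | inj₂ (inj₁ (c , c∈ , refl)) = ⊥-elim (tooth∉W c∈ w∈)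
  ... | inj₂ (inj₂ _)               = refl

  rank-spine : ∀ {c} → c ∈ cells → rank (spine c) ≡ B + level c
  rank-spine {c} c∈ with locate (spine c)
  ... | inj₁ (c′ , c′∈ , eq)        = cong (λ c → B + level c) (spine-injective c′∈ c∈ eq)
  ... | inj₂ (inj₁ (c′ , c′∈ , eq)) = ⊥-elim (spine≢tooth c∈ c′∈ (sym eq))
  ... | inj₂ (inj₂ neither)         = ⊥-elim (proj₁ (neither c∈) refl)

  rank-W : ∀ {w} → w ∈ W → rank w ≡ rank₀ w
  rank-W {w} w∈ with locate w
  ... | inj₁ (c , c∈ , refl)        = ⊥-elim (spine∉W c∈ w∈)
  ... | inj₂ (inj₁ (c , c∈ , refl)) = ⊥-elim (tooth∉W c∈ w∈)
  ... | inj₂ (inj₂ _) with w ∈? W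
  ...   | yes _ = refl
  ...   | no w∉ = ⊥-elim (w∉ w∈)

  rank-W-< : ∀ {w} → w ∈ W → ∀ k → rank w < B + k
  rank-W-< w∈ k = ≤-trans (≤-reflexive (cong suc (rank-W w∈))) (≤-trans (rank₀-<B w∈) (m≤m+n B k))

  entry-rank : ∀ {c} → c ∈ cells → rank (entry c) < B + level c
  entry-rank {c} c∈ with entry-from c∈
  ... | inj₁ e∈W                             = rank-W-< e∈W (level c)
  ... | inj₂ (c′ , c′∈ , refl , _ , lvl<) =
    ≤-trans (≤-reflexive (cong suc (rank-spine c′∈))) (+-monoʳ-< B lvl<)

  spine-rank-<L : ∀ {c} → c ∈ cells → rank (spine c) < B + L
  spine-rank-<L c∈ = ≤-trans (≤-reflexive (cong suc (rank-spine c∈))) (+-monoʳ-< B (level-<L c∈))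

  rank-par : ∀ x {v} → v ≢ root → rank (par x v) < rank v
  rank-par x {v} v≢ρ with locate v
  ... | inj₁ (c , c∈ , refl) = entry-rank c∈
  ... | inj₂ (inj₁ (c , c∈ , refl)) with toothParent-∈W x c
  ...   | inj₁ eq = subst (λ p → rank p < B + L) (sym eq) (spine-rank-<L c∈)
  ...   | inj₂ p∈ = rank-W-< p∈ L
  rank-par x {v} v≢ρ | inj₂ (inj₂ _) with v ∈? W
  ...   | yes v∈ = ≤-trans (≤-reflexive (cong suc (rank-W (par₀-∈W v)))) (rank₀-< v∈ v≢ρ)
  ...   | no _   = rank-W-< (par₀-∈W v) L

  tree : (Fin n → Bool) → RootedTree n
  tree x .RootedTree.root     = root
  tree x .RootedTree.par      = par x
  tree x .RootedTree.rank     = rank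
  tree x .RootedTree.par-root = trans (par-W x root∈W) par₀-root
  tree x .RootedTree.rank-par = rank-par x

  module Tree (x : Fin n → Bool) where
    open RootedTree (tree x) public
      using (graph; Edge; Edge-sym; Edge⇒adj; adj⇒Edge; par-edge; ⊆G-intro; isTree)

    spanning : IsSpanningTree G graph
    spanning = ⊆G-intro G par-adj , isTree
      where
      par-adj : ∀ {v} → v ≢ root → adj G v (par x v) ≡ true
      par-adj {v} v≢ρ with locate v
      ... | inj₁ (c , c∈ , refl) = adj-entry c∈
      ... | inj₂ (inj₂ _)        = par₀-adj v≢ρ
      ... | inj₂ (inj₁ (c , c∈ , refl)) with kid c
      ...   | nothing = adj-tooth c∈
      ...   | just _ with x (spine c)
      ...     | true  = adj-tooth c∈
      ...     | false = par₀-adj v≢ρ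

    spine≢root : ∀ {c} → c ∈ cells → spine c ≢ root
    spine≢root c∈ eq = spine∉W c∈ (subst (_∈ W) (sym eq) root∈W)

    tooth≢root : ∀ {c} → c ∈ cells → tooth c ≢ root
    tooth≢root c∈ eq = tooth∉W c∈ (subst (_∈ W) (sym eq) root∈W)

    entry-edge : ∀ {c} → c ∈ cells → Edge (entry c) (spine c)
    entry-edge c∈ = Edge-sym (subst (Edge _) (par-spine x c∈) (par-edge (spine≢root c∈)))

    tooth-edge : ∀ {c} → c ∈ cells → toothParent x c ≡ spine c → Edge (spine c) (tooth c)
    tooth-edge c∈ eq =
      Edge-sym (subst (Edge _) (trans (par-tooth x c∈) eq) (par-edge (tooth≢root c∈)))

    spine-child : ∀ {c u} → c ∈ cells → par x u ≡ spine c →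
      kid c ≡ just u ⊎ u ≡ tooth c × toothParent x c ≡ spine c
    spine-child {c} {u} c∈ eq with locate u
    ... | inj₂ (inj₂ _) = ⊥-elim (spine∉W c∈ (subst (_∈ W) eq (par₀-∈W u)))
    ... | inj₁ (c′ , c′∈ , refl) with entry-from c′∈
    ...   | inj₁ e∈W = ⊥-elim (spine∉W c∈ (subst (_∈ W) eq e∈W))
    ...   | inj₂ (c″ , c″∈ , eq′ , k , _) with refl ← spine-injective c″∈ c∈ (trans eq′ eq) = inj₁ k
    spine-child {c} {u} c∈ eq | inj₂ (inj₁ (c′ , c′∈ , refl)) with toothParent-∈W x c′
    ...   | inj₂ p∈ = ⊥-elim (spine∉W c∈ (subst (_∈ W) eq p∈))
    ...   | inj₁ eq′ with refl ← spine-injective c′∈ c∈ (trans (sym eq′) eq) = inj₂ (refl , eq)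

    tooth-childless : ∀ {c u} → c ∈ cells → par x u ≢ tooth c
    tooth-childless {c} {u} c∈ eq with locate u
    ... | inj₂ (inj₂ _) = tooth∉W c∈ (subst (_∈ W) eq (par₀-∈W u))
    ... | inj₁ (c′ , c′∈ , refl) with entry-from c′∈
    ...   | inj₁ e∈W                     = tooth∉W c∈ (subst (_∈ W) eq e∈W)
    ...   | inj₂ (c″ , c″∈ , eq′ , _ , _) = spine≢tooth c″∈ c∈ (trans eq′ eq)
    tooth-childless {c} {u} c∈ eq | inj₂ (inj₁ (c′ , c′∈ , refl)) with toothParent-∈W x c′
    ...   | inj₂ p∈  = tooth∉W c∈ (subst (_∈ W) eq p∈)
    ...   | inj₁ eq′ = spine≢tooth c′∈ c∈ (trans (sym eq′) eq)

    tooth-flat : ∀ {c} → c ∈ cells → toothParent x c ≡ spine c → ¬ HasOther graph (spine c) (tooth c)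
    tooth-flat c∈ eq (a , a≢s , e) with adj⇒Edge e
    ... | _ , inj₁ p = a≢s (trans (sym p) (trans (par-tooth x c∈) eq))
    ... | _ , inj₂ p = tooth-childless c∈ p

    -- Passing to the parent lowers the rank, so a vertex is never its own grandparent. This tells
    -- the continuation of a spine from the vertex through which it is entered.
    grandparent≢ : ∀ {c c′} → c ∈ cells → c′ ∈ cells → entry c′ ≡ spine c → spine c′ ≢ entry c
    grandparent≢ {c} {c′} c∈ c′∈ eq eq′ = <-asym
      (subst₂ _<_ (cong rank (par-spine x c∈)) refl (rank-par x (spine≢root c∈)))
      (subst₂ _<_ (cong rank (trans (par-spine x c′∈) eq)) (cong rank eq′)
        (rank-par x (spine≢root c′∈)))

    kid-edge : ∀ {c u} → c ∈ cells → kid c ≡ just u → Edge (spine c) u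
    kid-edge c∈ k with kid-cell c∈ k
    ... | c′ , c′∈ , refl , eq = subst (λ p → Edge p (spine c′)) eq (entry-edge c′∈)

    kid-hasOther : ∀ {c u} → c ∈ cells → kid c ≡ just u → HasOther graph (spine c) u
    kid-hasOther {c} c∈ k with kid-cell c∈ k
    ... | c′ , c′∈ , refl , eq with kid c′ in k′
    ...   | nothing = tooth c′ , (λ eq′ → spine≢tooth c∈ c′∈ (sym eq′)) ,
                      Edge⇒adj (tooth-edge c′∈ lemma)
      where
      lemma : toothParent x c′ ≡ spine c′
      lemma rewrite k′ = refl
    ...   | just w with kid-cell c′∈ k′
    ...     | c″ , c″∈ , refl , eq″ =
      spine c″ , (λ eq′ → grandparent≢ c′∈ c″∈ eq″ (trans eq′ (sym eq))) ,
      Edge⇒adj (kid-edge c′∈ k′)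

    kid-deep : ∀ {c u} → c ∈ cells → kid c ≡ just u → DeepChild graph (entry c) (spine c) u
    kid-deep {c} {u} c∈ k = Edge⇒adj (kid-edge c∈ k) , u≢entry , kid-hasOther c∈ k
      where
      u≢entry : u ≢ entry c
      u≢entry with kid-cell c∈ k
      ... | c′ , c′∈ , refl , eq = grandparent≢ c∈ c′∈ eq

    children : ∀ {c u} → c ∈ cells → adj graph (spine c) u ≡ true → u ≢ entry c →
      kid c ≡ just u ⊎ u ≡ tooth c × toothParent x c ≡ spine c
    children c∈ e u≢g with adj⇒Edge e
    ... | _ , inj₁ p = ⊥-elim (u≢g (trans (sym p) (par-spine x c∈)))
    ... | _ , inj₂ p = spine-child c∈ p

    deep-unique : ∀ {c u w} → c ∈ cells → kid c ≡ just w →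
      DeepChild graph (entry c) (spine c) u → u ≡ w
    deep-unique c∈ k (e , u≢g , other) with children c∈ e u≢g
    ... | inj₁ k′          = just-injective (trans (sym k′) k)
    ... | inj₂ (refl , tp) = ⊥-elim (tooth-flat c∈ tp other)

    -- Besides its entry, a spine vertex is adjacent to its kid, which is never a leaf, and possibly
    -- to its tooth, which then is a leaf. So a leaf is seen exactly when the bit is set.
    readBit-tree : ∀ {c w} → c ∈ cells → kid c ≡ just w →
      readBit graph (entry c) (spine c) ≡ x (spine c)
    readBit-tree {c} c∈ k with x (spine c) in xc
    ... | true = dec-true (flatChild? graph (entry c) (spine c))
      (tooth c , Edge⇒adj (tooth-edge c∈ tp) , tooth≢entry , tooth-flat c∈ tp)
      where
      tp : toothParent x c ≡ spine c
      tp rewrite k | xc = refl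
      tooth≢entry : tooth c ≢ entry c
      tooth≢entry eq with entry-from c∈
      ... | inj₁ e∈W                     = tooth∉W c∈ (subst (_∈ W) (sym eq) e∈W)
      ... | inj₂ (c′ , c′∈ , eq′ , _ , _) = spine≢tooth c′∈ c∈ (trans eq′ (sym eq))
    ... | false = dec-false (flatChild? graph (entry c) (spine c)) no-flat
      where
      no-flat : ¬ ∃ (FlatChild graph (entry c) (spine c))
      no-flat (u , e , u≢g , ¬other) with children c∈ e u≢g
      ... | inj₁ k′ = ¬other (kid-hasOther c∈ k′)
      ... | inj₂ (refl , tp) = spine∉W c∈ (subst (_∈ W) tp′ (par₀-∈W (tooth c)))
        where
        tp′ : par₀ (tooth c) ≡ spine c
        tp′ = trans (sym lemma) tp
          where
          lemma : toothParent x c ≡ par₀ (tooth c)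
          lemma rewrite k | xc = refl

  -- The constructors mention the scaffold but no bits: one program is valid for every tree of the
  -- family, so it can be run in a known tree to decode the bits of an unknown isomorphic one.
  data Plan : List (Instr n) → Set where
    []   : Plan []
    base : ∀ {v is} → v ∈ W → v ≢ root → Known root is (par₀ v) → Plan is →
           Plan (free v (par₀ v) ∷ is)
    head : ∀ {c is} → c ∈ cells → Known root is (entry c) → Plan is →
           Plan (free (spine c) (entry c) ∷ is)
    step : ∀ {c w is} → c ∈ cells → kid c ≡ just w → Known root is (spine c) →
           Known root is (entry c) → Plan is → Plan (forced w (spine c) (entry c) ∷ is)

  plan-valid : ∀ x {is} → Plan is → Valid (Tree.graph x) root is
  plan-valid x []                   = []
  plan-valid x (base v∈ v≢ρ kp p)   =
    free kp (Edge⇒adj (Edge-sym (subst (Edge _) (par-W x v∈) (par-edge v≢ρ)))) (plan-valid x p)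
    where open Tree x
  plan-valid x (head c∈ kp p)       =
    free kp (Tree.Edge⇒adj x (Tree.entry-edge x c∈)) (plan-valid x p)
  plan-valid x (step c∈ k kv ke p)  =
    forced kv ke (Tree.kid-deep x c∈ k) (Tree.deep-unique x c∈ k) (plan-valid x p)

lookup-injective : ∀ {a} {A : Set a} {xs : List A} → Unique xs →
  ∀ {i j} → List.lookup xs i ≡ List.lookup xs j → i ≡ j
lookup-injective (x∉ ∷ u) {zero}  {zero}  eq = refl
lookup-injective (x∉ ∷ u) {zero}  {suc j} eq = ⊥-elim (All.lookup x∉ (∈-lookup j) eq)
lookup-injective (x∉ ∷ u) {suc i} {zero}  eq = ⊥-elim (All.lookup x∉ (∈-lookup i) (sym eq))
lookup-injective (x∉ ∷ u) {suc i} {suc j} eq = cong suc (lookup-injective u eq)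

degree-mono : ∀ {n} {H G : Graph n} → H ⊆G G → ∀ u → degree H u ≤ degree G u
degree-mono {H = H} {G} H⊆G u = go (allVertices _)
  where
  bit-mono : ∀ v → bit (adj H u v) ≤ bit (adj G u v)
  bit-mono v with adj H u v in e
  ... | false = z≤n
  ... | true  = ≤-reflexive (cong bit (sym (H⊆G u v e)))
  go : ∀ vs → sum (map (λ v → bit (adj H u v)) vs) ≤ sum (map (λ v → bit (adj G u v)) vs)
  go []       = z≤n
  go (v ∷ vs) = +-mono-≤ (bit-mono v) (go vs)

-- Bit vectors as codes of trees, and their decoding

module Family {n} {G : Graph n} (S : Scaffold G) where
  open Scaffold S

  bits : List (Cell n)
  bits = filter hasKid? cells

  bitCell : Fin (length bits) → Cell n
  bitCell = List.lookup bits

  bitCell-∈ : ∀ i → bitCell i ∈ cells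
  bitCell-∈ i = proj₁ (∈-filter⁻ hasKid? {xs = cells} (∈-lookup i))

  bitCell-kid : ∀ i → ∃ λ w → kid (bitCell i) ≡ just w
  bitCell-kid i with kid (bitCell i) | proj₂ (∈-filter⁻ hasKid? {xs = cells} (∈-lookup i))
  ... | just w | _ = w , refl

  bitSpine-injective : ∀ {i j} → spine (bitCell i) ≡ spine (bitCell j) → i ≡ j
  bitSpine-injective {i} {j} eq =
    lookup-injective (filter⁺ hasKid? cells-unique) (spine-injective (bitCell-∈ i) (bitCell-∈ j) eq)

  choice : Vec Bool (length bits) → Fin n → Bool
  choice x u with any? (λ i → spine (bitCell i) ≟ u)
  ... | yes (i , _) = lookup x i
  ... | no _        = false

  choice-bit : ∀ x i → choice x (spine (bitCell i)) ≡ lookup x i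
  choice-bit x i with any? (λ j → spine (bitCell j) ≟ spine (bitCell i))
  ... | yes (j , eq) = cong (lookup x) (bitSpine-injective eq)
  ... | no ¬any      = ⊥-elim (¬any (i , refl))

  treeOf : Vec Bool (length bits) → Graph n
  treeOf x = Tree.graph (choice x)

  treeOf-spanning : ∀ x → IsSpanningTree G (treeOf x)
  treeOf-spanning x = Tree.spanning (choice x)

  module _ {program} (plan : Plan program)
           (spine-known : ∀ {c} → c ∈ cells → Known root program (spine c))
           (entry-known : ∀ {c} → c ∈ cells → Known root program (entry c)) where

    decode : Graph n → (Fin n → Fin n) → Vec Bool (length bits)
    decode H f = tabulate λ i → readBit H (f (entry (bitCell i))) (f (spine (bitCell i)))

    candidates : Vec Bool (length bits) → List (Vec Bool (length bits))
    candidates x = map (decode (treeOf x)) (run (treeOf x) program)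

    length-candidates : ∀ {Δ} → (∀ u → degree G u ≤ Δ) →
      ∀ x → length (candidates x) ≤ n * Δ ^ #free program
    length-candidates {Δ} deg≤ x = ≤-trans
      (≤-reflexive (length-map _ (run (treeOf x) program)))
      (length-run (treeOf x) Δ
        (λ u → ≤-trans (degree-mono {H = treeOf x} {G = G} (proj₁ (treeOf-spanning x)) u) (deg≤ u)) program)

    -- The run in `treeOf x` that follows the isomorphism finds the preimages of all spines and
    -- entries; looking for leaves there returns y. Thus everything isomorphic to `treeOf x` lies in
    -- a list whose length is governed by the number of free instructions.
    isomorphic⇒candidate : ∀ x y → Isomorphic (treeOf x) (treeOf y) → y ∈ candidates x
    isomorphic⇒candidate x y iso with run-complete (plan-valid (choice y) plan)
      where open Decoding (treeOf x) (treeOf y) iso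
    ... | f , f∈ , agree = subst (_∈ candidates x) decoded (∈-map⁺ _ f∈)
      where
      open Decoding (treeOf x) (treeOf y) iso
      decoded : decode (treeOf x) f ≡ y
      decoded = trans (tabulate-cong λ i → let c = bitCell i ; c∈ = bitCell-∈ i in begin
        readBit (treeOf x) (f (entry c)) (f (spine c))
          ≡⟨ cong₂ (readBit (treeOf x)) (agree (entry-known c∈)) (agree (spine-known c∈)) ⟩
        readBit (treeOf x) (ψ (entry c)) (ψ (spine c))
          ≡⟨ sym (readBit-ψ (entry c) (spine c)) ⟩
        readBit (treeOf y) (entry c) (spine c)
          ≡⟨ Tree.readBit-tree (choice y) c∈ (proj₂ (bitCell-kid i)) ⟩
        choice y (spine c)
          ≡⟨ choice-bit y i ⟩
        lookup y i ∎) (tabulate∘lookup y)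
        where open ≡-Reasoning

-- Extracting pairwise non-isomorphic trees

length-++-∷ : ∀ {a} {A : Set a} (xs : List A) {x ys} → length (xs ++ x ∷ ys) ≡ suc (length (xs ++ ys))
length-++-∷ []       = refl
length-++-∷ (_ ∷ xs) = cong suc (length-++-∷ xs)

Unique-⊆-length : ∀ {a} {A : Set a} {xs ys : List A} → Unique xs → (∀ {x} → x ∈ xs → x ∈ ys) →
  length xs ≤ length ys
Unique-⊆-length [] _ = z≤n
Unique-⊆-length {xs = x ∷ xs} (x∉ ∷ u) sub with ∈-∃++ (sub (here refl))
... | as , bs , refl =
  ≤-trans (s≤s (Unique-⊆-length u sub′)) (≤-reflexive (sym (length-++-∷ as)))
  where
  sub′ : ∀ {y} → y ∈ xs → y ∈ as ++ bs
  sub′ y∈ with ∈-++⁻ as (sub (there y∈))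
  ... | inj₁ y∈as         = ∈-++⁺ˡ y∈as
  ... | inj₂ (here refl)  = ⊥-elim (All.lookup x∉ y∈ refl)
  ... | inj₂ (there y∈bs) = ∈-++⁺ʳ as y∈bs

length-filter-¬ : ∀ {a p} {A : Set a} {P : A → Set p} (P? : ∀ x → Dec (P x)) xs →
  length xs ≡ length (filter P? xs) + length (filter (λ x → ¬? (P? x)) xs)
length-filter-¬ P? [] = refl
length-filter-¬ P? (x ∷ xs) with P? x
... | yes _ = cong suc (length-filter-¬ P? xs)
... | no _  = trans (cong suc (length-filter-¬ P? xs)) (sym (+-suc _ _))

module _ {A : Set} (_≟_ : DecidableEquality A) (N : A → List A) {K : ℕ}
         (N≤ : ∀ x → length (N x) ≤ K) (N-refl : ∀ x → x ∈ N x) where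

  open DecMembership _≟_ using (_∈?_)

  -- Greedy choice: keep x, delete `N x`, repeat. A kept element accounts for at most `K` removed
  -- ones, itself included by `N-refl`. Only pairs in list order are separated, since `N` need not
  -- be symmetric; m bounds the recursion.
  independent : ∀ m xs → length xs ≤ m → Unique xs → ∃ λ ys →
    (∀ {y} → y ∈ ys → y ∈ xs) × AllPairs (λ x y → y ∉ N x) ys × length xs ≤ length ys * K
  independent m       []       _         _        = [] , id , [] , z≤n
  independent (suc m) (x ∷ xs) (s≤s le) (x∉ ∷ u)
    with independent m (filter (λ y → ¬? (y ∈? N x)) xs)
           (≤-trans (≤-trans (m≤n+m _ _) (≤-reflexive (sym (length-filter-¬ (_∈? N x) xs)))) le)
           (filter⁺ _ u)
  ... | ys , ys⊆ , indep , bound =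
    x ∷ ys ,
    (λ { (here refl) → here refl ; (there y∈) → there (proj₁ (∈-filter⁻ _ {xs = xs} (ys⊆ y∈))) }) ,
    All.tabulate (λ y∈ → proj₂ (∈-filter⁻ (λ y → ¬? (y ∈? N x)) {xs = xs} (ys⊆ y∈))) ∷ indep ,
    (begin
      suc (length xs)
        ≡⟨ cong suc (length-filter-¬ (_∈? N x) xs) ⟩
      length (x ∷ filter (_∈? N x) xs) + length (filter (λ y → ¬? (y ∈? N x)) xs)
        ≤⟨ +-mono-≤ (≤-trans (Unique-⊆-length unique sub) (N≤ x)) bound ⟩
      K + length ys * K ∎)
    where
    open ≤-Reasoning
    unique : Unique (x ∷ filter (_∈? N x) xs)
    unique = All.tabulate (λ y∈ → All.lookup x∉ (proj₁ (∈-filter⁻ (_∈? N x) {xs = xs} y∈)))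
             ∷ filter⁺ (_∈? N x) u
    sub : ∀ {y} → y ∈ x ∷ filter (_∈? N x) xs → y ∈ N x
    sub (here refl) = N-refl x
    sub (there y∈)  = proj₂ (∈-filter⁻ (_∈? N x) {xs = xs} y∈)

allBits : ∀ m → List (Vec Bool m)
allBits zero    = [] ∷ []
allBits (suc m) = map (true ∷_) (allBits m) ++ map (false ∷_) (allBits m)

length-allBits : ∀ m → length (allBits m) ≡ 2 ^ m
length-allBits zero    = refl
length-allBits (suc m) = trans (length-++ (map (true ∷_) (allBits m)))
  (cong₂ _+_ (trans (length-map _ (allBits m)) (length-allBits m))
             (trans (trans (length-map _ (allBits m)) (length-allBits m)) (sym (+-identityʳ _))))

allBits-unique : ∀ m → Unique (allBits m)
allBits-unique zero    = All.[] ∷ []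
allBits-unique (suc m) =
  ++⁺ (map⁺ ∷-injectiveʳ (allBits-unique m)) (map⁺ ∷-injectiveʳ (allBits-unique m)) disjoint
  where
  disjoint : ∀ {v} → ¬ (v ∈ map (true ∷_) (allBits m) × v ∈ map (false ∷_) (allBits m))
  disjoint (t , f) with ∈-map⁻ _ t | ∈-map⁻ _ f
  ... | _ , _ , refl | _ , _ , ()

Isomorphic-refl : ∀ {n} (H : Graph n) → Isomorphic H H
Isomorphic-refl H = mk↔ₛ′ id id (λ _ → refl) (λ _ → refl) , λ _ _ → refl

module _ {n} {G : Graph n} (S : Scaffold G) where
  open Scaffold S
  open Family S

  manyTrees : ∀ {program Δ K} → Plan program →
    (∀ {c} → c ∈ cells → Known root program (spine c)) →
    (∀ {c} → c ∈ cells → Known root program (entry c)) →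
    (∀ u → degree G u ≤ Δ) → K * (n * Δ ^ #free program) ≤ 2 ^ length bits →
    n * Δ ^ #free program ≢ 0 →
    AtLeastUnlabeledSpanningTrees G K
  manyTrees {program} {Δ} {K} plan sk ek deg≤ bound pos
    with independent (≡-dec Bool._≟_) (candidates plan sk ek) {n * Δ ^ #free program}
           (length-candidates plan sk ek deg≤)
           (λ x → isomorphic⇒candidate plan sk ek x x (Isomorphic-refl (treeOf x)))
           _ (allBits (length bits)) ≤-refl (allBits-unique (length bits))
  ... | ys , _ , indep , le =
    map treeOf (take K ys) ,
    trans (length-map treeOf (take K ys)) (trans (length-take K ys) (m≤n⇒m⊓n≡m K≤)) ,
    (λ H∈ → spanning (∈-map⁻ treeOf H∈)) ,
    AllPairs.map⁺ (AllPairs.take⁺ K (AllPairs.map (λ y∉ iso → y∉ (isomorphic⇒candidate plan sk ek _ _ iso)) indep))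
    where
    spanning : ∀ {H} → (∃ λ x → x ∈ take K ys × H ≡ treeOf x) → IsSpanningTree G H
    spanning (x , _ , refl) = treeOf-spanning x
    K≤ : K ≤ length ys
    K≤ = *-cancelʳ-≤ K (length ys) (n * Δ ^ #free program) {{≢-nonZero pos}}
      (≤-trans bound (≤-trans (≤-reflexive (sym (length-allBits (length bits)))) le))

-- A small connected dominating set

length-allVertices : ∀ n → length (allVertices n) ≡ n
length-allVertices zero    = refl
length-allVertices (suc n) = cong suc (trans (length-map suc (allVertices n)) (length-allVertices n))

module _ {A : Set} where

  sum-map-mono : {f g : A → ℕ} → (∀ a → f a ≤ g a) → ∀ xs → sum (map f xs) ≤ sum (map g xs)
  sum-map-mono h []       = z≤n
  sum-map-mono h (x ∷ xs) = +-mono-≤ (h x) (sum-map-mono h xs)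

  sum-map-≤ : {f : A → ℕ} {k : ℕ} → (∀ a → f a ≤ k) → ∀ xs → sum (map f xs) ≤ length xs * k
  sum-map-≤ h []       = z≤n
  sum-map-≤ h (x ∷ xs) = +-mono-≤ (h x) (sum-map-≤ h xs)

  sum-map-+ : (f g : A → ℕ) → ∀ xs → sum (map (λ a → f a + g a) xs) ≡ sum (map f xs) + sum (map g xs)
  sum-map-+ f g []       = refl
  sum-map-+ f g (x ∷ xs) = trans (cong (f x + g x +_) (sum-map-+ f g xs))
                                 (+-lemma (f x) (g x) (sum (map f xs)) (sum (map g xs)))
    where
    +-lemma : ∀ a b c d → (a + b) + (c + d) ≡ (a + c) + (b + d)
    +-lemma = solve-∀

module _ {n} (G : Graph n) where

  count : Fin n → List (Fin n) → ℕ
  count v P = sum (map (λ u → bit (adj G v u)) P)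

  edges : List (Fin n) → List (Fin n) → ℕ
  edges P Q = sum (map (λ u → count u Q) P)

  bit≤1 : ∀ b → bit b ≤ 1
  bit≤1 true  = ≤-refl
  bit≤1 false = z≤n

  count≤length : ∀ v P → count v P ≤ length P
  count≤length v P = ≤-trans (sum-map-≤ (λ u → bit≤1 (adj G v u)) P) (≤-reflexive (*-identityʳ (length P)))

  degree≤n : ∀ v → degree G v ≤ n
  degree≤n v = ≤-trans (count≤length v (allVertices n)) (≤-reflexive (length-allVertices n))

  count-++ : ∀ v P Q → count v (P ++ Q) ≡ count v P + count v Q
  count-++ v P Q = trans (cong sum (map-++ (λ u → bit (adj G v u)) P Q)) (sum-++ (map (λ u → bit (adj G v u)) P) _)

  count-↭ : ∀ v {P Q} → P ↭ Q → count v P ≡ count v Q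
  count-↭ v P↭Q = sum-↭ (Perm.map⁺ (λ u → bit (adj G v u)) P↭Q)

  edges-[]ʳ : ∀ P → edges P [] ≡ 0
  edges-[]ʳ []      = refl
  edges-[]ʳ (_ ∷ P) = edges-[]ʳ P

  edges-∷ʳ : ∀ v P Q → edges P (v ∷ Q) ≡ count v P + edges P Q
  edges-∷ʳ v P Q = trans (sum-map-+ (λ u → bit (adj G u v)) (λ u → count u Q) P) (cong (_+ edges P Q) (go P))
    where
    go : ∀ P → sum (map (λ u → bit (adj G u v)) P) ≡ count v P
    go []      = refl
    go (u ∷ P) = cong₂ _+_ (cong bit (Graph.sym G u v)) (go P)

  edges-comm : ∀ P Q → edges P Q ≡ edges Q P
  edges-comm P []      = edges-[]ʳ P
  edges-comm P (v ∷ Q) = trans (edges-∷ʳ v P Q) (cong (count v P +_) (edges-comm P Q))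

  count-filter-¬ : ∀ {p} {P : Fin n → Set p} (P? : ∀ x → Dec (P x)) v U →
    count v U ≡ count v (filter P? U) + count v (filter (λ x → ¬? (P? x)) U)
  count-filter-¬ P? v []      = refl
  count-filter-¬ P? v (u ∷ U) with P? u
  ... | yes _ = trans (cong (bit (adj G v u) +_) (count-filter-¬ P? v U)) (sym (+-assoc (bit (adj G v u)) _ _))
  ... | no _  = trans (cong (bit (adj G v u) +_) (count-filter-¬ P? v U))
    (lemma (bit (adj G v u)) (count v (filter P? U)) (count v (filter (λ x → ¬? (P? x)) U)))
    where
    lemma : ∀ a b c → a + (b + c) ≡ b + (a + c)
    lemma = solve-∀

  count-filter-≤ : ∀ {p} {P : Fin n → Set p} (P? : ∀ x → Dec (P x)) v U → count v (filter P? U) ≤ count v U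
  count-filter-≤ P? v U = ≤-trans (m≤m+n _ _) (≤-reflexive (sym (count-filter-¬ P? v U)))

  nonadj? : ∀ v u → Dec (adj G v u ≡ false)
  nonadj? v u = adj G v u Bool.≟ false

  count-nonadj : ∀ v U → count v (filter (nonadj? v) U) ≡ 0
  count-nonadj v []      = refl
  count-nonadj v (u ∷ U) with adj G v u in e
  ... | true  = count-nonadj v U
  ... | false rewrite e = count-nonadj v U

  length-nonadj : ∀ v U → count v U + length (filter (nonadj? v) U) ≡ length U
  length-nonadj v []      = refl
  length-nonadj v (u ∷ U) with adj G v u
  ... | true  = cong suc (length-nonadj v U)
  ... | false = trans (+-suc _ _) (cong suc (length-nonadj v U))

  -- State of a greedy pass: a vertex with more than q uncovered neighbours becomes a centre and
  -- covers them. As `uncovered` only shrinks, a vertex once treated keeps at most q uncovered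
  -- neighbours, and one pass suffices. Each centre covers more than q new vertices, whence `size`.
  record Cover (q : ℕ) (vs : List (Fin n)) : Set where
    field
      centres uncovered : List (Fin n)
      few       : ∀ {v} → v ∈ vs → count v uncovered ≤ q
      dominated : ∀ u → u ∈ uncovered ⊎ Any (λ w → adj G w u ≡ true) centres
      size      : length centres * q + length uncovered ≤ n

  cover : ∀ q vs → Cover q vs
  cover q [] = record
    { centres = [] ; uncovered = allVertices n ; few = λ ()
    ; dominated = λ u → inj₁ (∈-allVertices u) ; size = ≤-reflexive (length-allVertices n) }
  cover q (v ∷ vs) with cover q vs
  ... | record { centres = D ; uncovered = U ; few = few ; dominated = dom ; size = size } with count v U ≤? q
  ... | yes le = record
    { centres = D ; uncovered = U ; few = λ { (here refl) → le ; (there v∈) → few v∈ }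
    ; dominated = dom ; size = size }
  ... | no ¬le = record
    { centres = v ∷ D ; uncovered = U′
    ; few = λ { (here refl) → ≤-trans (≤-reflexive (count-nonadj v U)) z≤n
              ; (there v∈)  → ≤-trans (count-filter-≤ (nonadj? v) _ U) (few v∈) }
    ; dominated = dom′
    ; size = begin
        q + length D * q + length U′            ≤⟨ +-monoˡ-≤ (length U′) (+-monoˡ-≤ (length D * q) (<⇒≤ (≰⇒> ¬le))) ⟩
        count v U + length D * q + length U′    ≡⟨ lemma (count v U) (length D * q) (length U′) ⟩
        length D * q + (count v U + length U′)  ≡⟨ cong (length D * q +_) (length-nonadj v U) ⟩
        length D * q + length U                 ≤⟨ size ⟩
        n                                       ∎ }
    where
    open ≤-Reasoning
    U′ = filter (nonadj? v) U
    lemma : ∀ a b c → a + b + c ≡ b + (a + c)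
    lemma = solve-∀
    dom′ : ∀ u → u ∈ U′ ⊎ Any (λ w → adj G w u ≡ true) (v ∷ D)
    dom′ u with dom u
    ... | inj₂ near = inj₂ (there near)
    ... | inj₁ u∈U with adj G v u in e
    ...   | true  = inj₂ (here e)
    ...   | false = inj₁ (∈-filter⁺ (nonadj? v) u∈U e)

  length*d≤edges : ∀ {d} → (∀ v → d ≤ 2 * degree G v) → ∀ U → length U * d ≤ 2 * edges U (allVertices n)
  length*d≤edges deg≥ []      = z≤n
  length*d≤edges deg≥ (u ∷ U) = ≤-trans (+-mono-≤ (deg≥ u) (length*d≤edges deg≥ U))
    (≤-reflexive (sym (*-distribˡ-+ 2 (degree G u) (edges U (allVertices n)))))

  -- Double counting of the edges at uncovered vertices: at least d/2 from each of them, at most q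
  -- at every vertex of the graph.
  uncovered-bound : ∀ {d q} → (∀ v → d ≤ 2 * degree G v) → (C : Cover q (allVertices n)) →
    length (Cover.uncovered C) * d ≤ 2 * (n * q)
  uncovered-bound {d} {q} deg≥ C = begin
    length U * d                        ≤⟨ length*d≤edges deg≥ U ⟩
    2 * edges U (allVertices n)         ≡⟨ cong (2 *_) (edges-comm U (allVertices n)) ⟩
    2 * edges (allVertices n) U         ≤⟨ *-monoʳ-≤ 2 (sum-map-≤ (λ v → few (∈-allVertices v)) (allVertices n)) ⟩
    2 * (length (allVertices n) * q)    ≡⟨ cong (λ k → 2 * (k * q)) (length-allVertices n) ⟩
    2 * (n * q)                         ∎
    where
    open ≤-Reasoning
    open Cover C renaming (uncovered to U)

  Near : List (Fin n) → Fin n → Set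
  Near W u = Any (λ w → w ≡ u ⊎ adj G w u ≡ true) W

  near? : ∀ W u → Dec (Near W u)
  near? W u = Any.any? (λ w → (w ≟ u) ⊎-dec (adj G w u Bool.≟ true)) W

  near-⊆ : ∀ {W W′ u} → (∀ {w} → w ∈ W → w ∈ W′) → Near W u → Near W′ u
  near-⊆ sub near = let w , w∈ , h = find near in lose (sub w∈) h

  -- A derivation records the order in which the vertices joined and to whom. The tree on W
  -- (`parOf`), its ranks (`rankOf`) and the program naming W (`planTree`) are obtained by recursion
  -- on it.
  data Grown (ρ : Fin n) : List (Fin n) → Set where
    seed : Grown ρ (ρ ∷ [])
    grow : ∀ {c p W} → c ∉ W → p ∈ W → adj G c p ≡ true → Grown ρ W → Grown ρ (c ∷ W)

  root∈ : ∀ {ρ W} → Grown ρ W → ρ ∈ W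
  root∈ seed           = here refl
  root∈ (grow _ _ _ g) = there (root∈ g)

  record Extension (ρ : Fin n) (W : List (Fin n)) (k : ℕ) (c : Fin n) : Set where
    field
      {W′} : List (Fin n)
      grown : Grown ρ W′
      incl  : ∀ {w} → w ∈ W → w ∈ W′
      new   : c ∈ W′
      size  : length W′ ≤ k + length W
  open Extension

  open DecMembership (_≟_ {n}) using (_∈?_)

  absorb : ∀ {ρ W c} → Grown ρ W → Near W c → Extension ρ W 1 c
  absorb {W = W} {c} g near with c ∈? W
  ... | yes c∈ = record { grown = g ; incl = id ; new = c∈ ; size = n≤1+n _ }
  ... | no c∉ with find near
  ...   | w , w∈ , inj₁ refl = ⊥-elim (c∉ w∈)
  ...   | w , w∈ , inj₂ e    = record
    { grown = grow c∉ w∈ (trans (Graph.sym G c w) e) g ; incl = there ; new = here refl ; size = ≤-refl }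

  exit : ∀ W {u v} → Near W u → Reachable G u v →
    Near W v ⊎ ∃₂ λ y z → Near W y × adj G y z ≡ true × ¬ Near W z
  exit W near here = inj₁ near
  exit W near (step {w = z} e r) with near? W z
  ... | yes near′ = exit W near′ r
  ... | no ¬near  = inj₂ (_ , z , near , e , ¬near)

  Dominating : List (Fin n) → Set
  Dominating W = ∀ u → Near W u

  -- If a walk from W leaves the neighbourhood of W, the vertex where it does so is dominated by R,
  -- hence three new vertices suffice to connect some element of R to W.
  advance : Connected G → ∀ {ρ W R d} → Grown ρ W → d ∈ R → (∀ u → Near W u ⊎ Near R u) →
    ∃ λ c → c ∈ R × Extension ρ W 3 c
  advance conn {ρ} {W} {R} {d} g d∈ dom with exit W (lose (root∈ g) (inj₁ refl)) (conn ρ d)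
  ... | inj₁ near = d , d∈ , record
    { grown = grown x ; incl = incl x ; new = new x ; size = ≤-trans (size x) (m≤n+m _ 2) }
    where x = absorb g near
  ... | inj₂ (y , z , near-y , e , ¬near-z) with dom z
  ...   | inj₁ near-z = ⊥-elim (¬near-z near-z)
  ...   | inj₂ near-z with find near-z
  ...     | c , c∈ , h = c , c∈ , record
    { grown = grown x₃ ; incl = incl x₃ ∘ incl x₂ ∘ incl x₁ ; new = new x₃
    ; size = ≤-trans (size x₃) (s≤s (≤-trans (size x₂) (s≤s (size x₁)))) }
    where
    x₁ = absorb g near-y
    x₂ = absorb (grown x₁) (lose (new x₁) (inj₂ e))
    back : c ≡ z ⊎ adj G c z ≡ true → z ≡ c ⊎ adj G z c ≡ true
    back (inj₁ eq) = inj₁ (sym eq)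
    back (inj₂ e)  = inj₂ (trans (Graph.sym G z c) e)
    x₃ = absorb (grown x₂) (lose (new x₂) (back h))

  -- Each round moves one element of `R` into the tree at the price of at most three vertices, and
  -- the rest of `R` still dominates whatever the tree does not.
  connect : Connected G → ∀ m {ρ W} R → length R ≤ m → Grown ρ W → (∀ u → Near W u ⊎ Near R u) →
    ∃ λ W′ → Grown ρ W′ × Dominating W′ × length W′ ≤ 3 * length R + length W
  connect conn m {W = W} [] _ g dom =
    W , g , (λ u → case dom u of λ { (inj₁ near) → near }) , ≤-refl
  connect conn (suc m) {W = W} R@(_ ∷ _) le g dom with advance conn g (here refl) dom
  ... | c , c∈ , x with ∈-∃++ c∈
  ... | as , bs , eq with connect conn m (as ++ bs) le′ (grown x) dom′
    where
    R-length : length R ≡ suc (length (as ++ bs))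
    R-length = trans (cong length eq) (length-++-∷ as)
    le′ : length (as ++ bs) ≤ m
    le′ = s≤s⁻¹ (subst (_≤ suc m) R-length le)
    dom′ : ∀ u → Near (W′ x) u ⊎ Near (as ++ bs) u
    dom′ u with dom u
    ... | inj₁ near = inj₁ (near-⊆ (incl x) near)
    ... | inj₂ near with Any.++⁻ as (subst (λ R → Near R u) eq near)
    ...   | inj₁ a         = inj₂ (Any.++⁺ˡ a)
    -- Here u was dominated by c itself, which has just joined the tree.
    ...   | inj₂ (here h)  = inj₁ (lose (new x) h)
    ...   | inj₂ (there b) = inj₂ (Any.++⁺ʳ as b)
  ... | W″ , g″ , dom″ , size″ = W″ , g″ , dom″ , (begin
      length W″                                     ≤⟨ size″ ⟩
      3 * length (as ++ bs) + length (W′ x)         ≤⟨ +-monoʳ-≤ (3 * length (as ++ bs)) (size x) ⟩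
      3 * length (as ++ bs) + (3 + length W)        ≡⟨ lemma (length (as ++ bs)) (length W) ⟩
      3 * suc (length (as ++ bs)) + length W        ≡⟨ cong (λ k → 3 * k + length W) (sym R-length) ⟩
      3 * length R + length W                       ∎)
    where
    open ≤-Reasoning
    R-length : length R ≡ suc (length (as ++ bs))
    R-length = trans (cong length eq) (length-++-∷ as)
    lemma : ∀ a w → 3 * a + (3 + w) ≡ 3 * suc a + w
    lemma = solve-∀

  -- a counts the chosen centres and b the vertices that they leave uncovered.
  record DominatingTree (ρ : Fin n) (q d : ℕ) : Set where
    field
      W          : List (Fin n)
      grown      : Grown ρ W
      dominating : Dominating W
      a b        : ℕ
      size       : length W ≤ 3 * (a + b) + 1
      a-bound    : a * q ≤ n
      b-bound    : b * d ≤ 2 * (n * q)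

  -- The set to be connected consists of the centres and of the uncovered vertices themselves, so
  -- that it dominates everything.
  dominatingTree : Connected G → ∀ {d} → (∀ v → d ≤ 2 * degree G v) → ∀ ρ q → DominatingTree ρ q d
  dominatingTree conn deg≥ ρ q
    with connect conn _ (D ++ U) ≤-refl (seed {ρ}) dom
    where
    open Cover (cover q (allVertices n)) renaming (centres to D; uncovered to U)
    dom : ∀ u → Near (ρ ∷ []) u ⊎ Near (D ++ U) u
    dom u with dominated u
    ... | inj₁ u∈U  = inj₂ (Any.++⁺ʳ D (lose u∈U (inj₁ refl)))
    ... | inj₂ near = inj₂ (Any.++⁺ˡ (Any.map inj₂ near))
  ... | W , g , dom , size = record
    { W = W ; grown = g ; dominating = dom ; a = length D ; b = length U
    ; size = ≤-trans size (≤-reflexive (cong (λ k → 3 * k + 1) (length-++ D)))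
    ; a-bound = ≤-trans (m≤m+n _ _) (Cover.size C)
    ; b-bound = uncovered-bound deg≥ C }
    where
    C = cover q (allVertices n)
    open Cover C using () renaming (centres to D; uncovered to U)

-- Packing combs

vertices : ∀ {n} → List (Cell n) → List (Fin n)
vertices = concatMap λ c → spine c ∷ tooth c ∷ []

module _ {n} (G : Graph n) where

  data Comb : (g v : Fin n) (k lvl : ℕ) → List (Cell n) → Set where
    end  : ∀ {g v r lvl} → adj G v g ≡ true → adj G r v ≡ true →
           Comb g v 1 lvl (cell v r g nothing lvl ∷ [])
    more : ∀ {g v r v′ k lvl cs} → adj G v g ≡ true → adj G r v ≡ true →
           Comb v v′ k (suc lvl) cs → Comb g v (suc k) lvl (cell v r g (just v′) lvl ∷ cs)

  pick : ∀ v P → count G v P ≡ 0 ⊎ ∃₂ λ u P′ → P ↭ u ∷ P′ × adj G u v ≡ true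
  pick v [] = inj₁ refl
  pick v (u ∷ P) with adj G v u in e
  ... | true = inj₂ (u , P , ↭-refl , trans (Graph.sym G u v) e)
  ... | false with pick v P
  ...   | inj₁ none               = inj₁ none
  ...   | inj₂ (w , P′ , perm , e′) =
    inj₂ (w , u ∷ P′ , ↭-trans (prep u perm) (swap u w ↭-refl) , e′)

  CombIn : (k lvl : ℕ) (g v : Fin n) → List (Fin n) → Set
  CombIn k lvl g v Q = ∃₂ λ cs P′ → Comb g v k lvl cs × Q ↭ vertices cs ++ P′

  LowDegreeIn : ℕ → List (Fin n) → Set
  LowDegreeIn b Q = ∃₂ λ u P′ → Q ↭ u ∷ P′ × count G u P′ ≤ b

  -- Greedy search without backtracking: take a tooth, then the next spine vertex, among the
  -- available vertices. Where it gets stuck, at most one neighbour is still available; all others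
  -- in the list were used by this very comb. Unwinding the recursion returns a spine vertex and a
  -- tooth per level to the rest, which adds at most 2 to the count.
  findComb : ∀ k lvl g v P → adj G v g ≡ true →
    CombIn (suc k) lvl g v (v ∷ P) ⊎ LowDegreeIn (2 * suc k) (v ∷ P)
  findComb k lvl g v P e with pick v P
  ... | inj₁ none = inj₂ (v , P , ↭-refl , ≤-trans (≤-reflexive none) z≤n)
  findComb zero lvl g v P e | inj₂ (r , P₁ , perm , er) =
    inj₁ (_ , P₁ , end e er , prep v perm)
  findComb (suc k) lvl g v P e | inj₂ (r , P₁ , perm , er) with pick v P₁
  ... | inj₁ none = inj₂ (v , P , ↭-refl , (begin
    count G v P                        ≡⟨ count-↭ G v perm ⟩
    bit (adj G v r) + count G v P₁     ≡⟨ cong (bit (adj G v r) +_) none ⟩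
    bit (adj G v r) + 0                ≤⟨ +-monoˡ-≤ 0 (bit≤1 G (adj G v r)) ⟩
    1                                  ≤⟨ s≤s z≤n ⟩
    2 * suc (suc k)                    ∎))
    where open ≤-Reasoning
  ... | inj₂ (v′ , P₂ , perm₂ , ev) with findComb k (suc lvl) v v′ P₂ ev
  ...   | inj₁ (cs , P′ , comb , perm₃) =
    inj₁ (_ , P′ , more e er comb , prep v (↭-trans perm (prep r (↭-trans perm₂ perm₃))))
  ...   | inj₂ (u , P′ , perm₃ , low) =
    inj₂ (u , v ∷ r ∷ P′ ,
      ↭-trans (prep v (↭-trans perm (prep r (↭-trans perm₂ perm₃)))) (Perm.shift u (v ∷ r ∷ []) P′) ,
      (begin
        bit (adj G u v) + (bit (adj G u r) + count G u P′)
          ≤⟨ +-mono-≤ (bit≤1 G (adj G u v)) (+-mono-≤ (bit≤1 G (adj G u r)) low) ⟩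
        2 + 2 * suc k      ≡⟨ sym (*-suc 2 (suc k)) ⟩
        2 * suc (suc k)    ∎))
    where open ≤-Reasoning

  data Packed (f : Fin n → Fin n) (L : ℕ) : ℕ → List (Cell n) → Set where
    []  : Packed f L 0 []
    _∷_ : ∀ {t v cs cells} → Comb (f v) v L 0 cs → Packed f L t cells → Packed f L (suc t) (cs ++ cells)

  -- A vertex is declared dead when it has at most 2 L neighbours among the vertices still available,
  -- in particular among those that die later.
  record Packing (f : Fin n → Fin n) (L : ℕ) (U : List (Fin n)) : Set where
    field
      {t}       : ℕ
      {cells}   : List (Cell n)
      dead      : List (Fin n)
      packed    : Packed f L t cells
      split     : U ↭ vertices cells ++ dead
      sparse    : edges G dead dead ≤ 4 * L * length dead

  edges-∷ : ∀ v D → edges G (v ∷ D) (v ∷ D) ≡ 2 * count G v D + edges G D D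
  edges-∷ v D = begin
    bit (adj G v v) + count G v D + edges G D (v ∷ D)
      ≡⟨ cong₂ (λ b e → bit b + count G v D + e) (irrefl G v) (edges-∷ʳ G v D D) ⟩
    count G v D + (count G v D + edges G D D)
      ≡⟨ lemma (count G v D) (edges G D D) ⟩
    2 * count G v D + edges G D D ∎
    where
    open ≡-Reasoning
    lemma : ∀ c e → c + (c + e) ≡ 2 * c + e
    lemma = solve-∀

  vertices-++ : ∀ (cs : List (Cell n)) {ds} → vertices (cs ++ ds) ≡ vertices cs ++ vertices ds
  vertices-++ cs = concatMap-++ _ cs _

  comb-nonempty : ∀ {g v k lvl cs} → Comb g v k lvl cs → ∃₂ λ c cs′ → cs ≡ c ∷ cs′
  comb-nonempty (end _ _)    = _ , _ , refl
  comb-nonempty (more _ _ _) = _ , _ , refl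

  -- A dying vertex has at most 2L neighbours among those that die later; `edges` counts ordered
  -- pairs, hence each such edge twice, which gives 4L per dead vertex.
  pack : ∀ (f : Fin n → Fin n) l m U → length U ≤ m → (∀ {u} → u ∈ U → adj G u (f u) ≡ true) →
    Packing f (suc l) U
  pack f l m [] _ _ = record { dead = [] ; packed = [] ; split = ↭-refl ; sparse = z≤n }
  pack f l (suc m) (v ∷ P) le adj-f with findComb l 0 (f v) v P (adj-f (here refl))
  ... | inj₁ (cs , P′ , comb , perm) = record
    { dead = dead ; packed = comb ∷ packed
    ; split = ↭-trans perm (↭-trans (Perm.++⁺ˡ (vertices cs) split) (↭-reflexive
        (trans (sym (++-assoc (vertices cs) _ dead)) (cong (_++ dead) (sym (vertices-++ cs))))))
    ; sparse = sparse }
    where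
    shorter : length P′ ≤ m
    shorter with comb-nonempty comb
    ... | _ , cs′ , refl = s≤s⁻¹ (begin
      suc (length P′)                             ≤⟨ s≤s (m≤n+m (length P′) (suc (length (vertices cs′)))) ⟩
      2 + length (vertices cs′) + length P′       ≡⟨ sym (length-++ (vertices cs)) ⟩
      length (vertices cs ++ P′)                  ≡⟨ sym (Perm.↭-length perm) ⟩
      suc (length P)                              ≤⟨ le ⟩
      suc m                                       ∎)
      where open ≤-Reasoning
    open Packing (pack f l m P′ shorter
      (λ u∈ → adj-f (Perm.∈-resp-↭ (↭-sym perm) (∈-++⁺ʳ (vertices cs) u∈))))
  ... | inj₂ (u , P′ , perm , low) = record
    { dead = u ∷ dead ; packed = packed
    ; split = ↭-trans perm (↭-trans (prep u split) (↭-sym (Perm.shift u (vertices cells) dead)))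
    ; sparse = begin
        edges G (u ∷ dead) (u ∷ dead)             ≡⟨ edges-∷ u dead ⟩
        2 * count G u dead + edges G dead dead    ≤⟨ +-mono-≤ (*-monoʳ-≤ 2 (≤-trans dead≤ low)) sparse ⟩
        2 * (2 * suc l) + 4 * suc l * length dead ≡⟨ lemma (suc l) (length dead) ⟩
        4 * suc l * suc (length dead)             ∎ }
    where
    open ≤-Reasoning
    shorter : length P′ ≤ m
    shorter = s≤s⁻¹ (≤-trans (≤-reflexive (sym (Perm.↭-length perm))) le)
    open Packing (pack f l m P′ shorter (λ w∈ → adj-f (Perm.∈-resp-↭ (↭-sym perm) (there w∈))))
    dead≤ : count G u dead ≤ count G u P′
    dead≤ = ≤-trans (m≤n+m _ (count G u (vertices cells)))
      (≤-reflexive (sym (trans (count-↭ G u split) (count-++ G u (vertices cells) dead))))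
    lemma : ∀ s x → 2 * (2 * s) + 4 * s * x ≡ 4 * s * suc x
    lemma = solve-∀

-- From a packing to a scaffold

allVertices-unique : ∀ n → Unique (allVertices n)
allVertices-unique zero    = []
allVertices-unique (suc n) =
  All.tabulate (λ v∈ → zero≢ (∈-map⁻ suc v∈)) ∷ map⁺ suc-injective (allVertices-unique n)
  where
  zero≢ : ∀ {v} → (∃ λ u → u ∈ allVertices n × v ≡ suc u) → zero ≢ v
  zero≢ (_ , _ , refl) ()

Unique-++⁻ˡ : ∀ {a} {A : Set a} (xs : List A) {ys} → Unique (xs ++ ys) → Unique xs
Unique-++⁻ˡ []       _         = []
Unique-++⁻ˡ (x ∷ xs) (x∉ ∷ u) = All.tabulate (λ y∈ → All.lookup x∉ (∈-++⁺ˡ y∈)) ∷ Unique-++⁻ˡ xs u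

module _ {n : ℕ} where

  spine∈ : ∀ {c} {cs : List (Cell n)} → c ∈ cs → spine c ∈ vertices cs
  spine∈ (here refl) = here refl
  spine∈ (there c∈)  = there (there (spine∈ c∈))

  tooth∈ : ∀ {c} {cs : List (Cell n)} → c ∈ cs → tooth c ∈ vertices cs
  tooth∈ (here refl) = there (here refl)
  tooth∈ (there c∈)  = there (there (tooth∈ c∈))

  length-vertices : ∀ (cs : List (Cell n)) → length (vertices cs) ≡ 2 * length cs
  length-vertices []       = refl
  length-vertices (c ∷ cs) = trans (cong (2 +_) (length-vertices cs)) (sym (*-suc 2 (length cs)))

  spine-inj : ∀ {cs : List (Cell n)} → Unique (vertices cs) →
    ∀ {c c′} → c ∈ cs → c′ ∈ cs → spine c ≡ spine c′ → c ≡ c′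
  spine-inj _ (here refl) (here refl) eq = refl
  spine-inj (s∉ ∷ _) (here refl) (there c′∈) eq = ⊥-elim (All.lookup s∉ (there (spine∈ c′∈)) eq)
  spine-inj (s∉ ∷ _) (there c∈) (here refl) eq = ⊥-elim (All.lookup s∉ (there (spine∈ c∈)) (sym eq))
  spine-inj (_ ∷ _ ∷ u) (there c∈) (there c′∈) eq = spine-inj u c∈ c′∈ eq

  tooth-inj : ∀ {cs : List (Cell n)} → Unique (vertices cs) →
    ∀ {c c′} → c ∈ cs → c′ ∈ cs → tooth c ≡ tooth c′ → c ≡ c′
  tooth-inj _ (here refl) (here refl) eq = refl
  tooth-inj (_ ∷ t∉ ∷ _) (here refl) (there c′∈) eq = ⊥-elim (All.lookup t∉ (tooth∈ c′∈) eq)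
  tooth-inj (_ ∷ t∉ ∷ _) (there c∈) (here refl) eq = ⊥-elim (All.lookup t∉ (tooth∈ c∈) (sym eq))
  tooth-inj (_ ∷ _ ∷ u) (there c∈) (there c′∈) eq = tooth-inj u c∈ c′∈ eq

  spine≢tooth′ : ∀ {cs : List (Cell n)} → Unique (vertices cs) →
    ∀ {c c′} → c ∈ cs → c′ ∈ cs → spine c ≢ tooth c′
  spine≢tooth′ (s∉ ∷ _) (here refl) (here refl) eq = All.lookup s∉ (here refl) eq
  spine≢tooth′ (s∉ ∷ _) (here refl) (there c′∈) eq = All.lookup s∉ (there (tooth∈ c′∈)) eq
  spine≢tooth′ (_ ∷ t∉ ∷ _) (there c∈) (here refl) eq = All.lookup t∉ (spine∈ c∈) (sym eq)
  spine≢tooth′ (_ ∷ _ ∷ u) (there c∈) (there c′∈) eq = spine≢tooth′ u c∈ c′∈ eq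

  cells-unique′ : ∀ {cs : List (Cell n)} → Unique (vertices cs) → Unique cs
  cells-unique′ {[]}     _           = []
  cells-unique′ {c ∷ cs} (s∉ ∷ _ ∷ u) =
    All.tabulate (λ c′∈ eq → All.lookup s∉ (there (spine∈ c′∈)) (cong spine eq)) ∷ cells-unique′ u

module _ {n} {G : Graph n} where

  comb-head : ∀ {g v k lvl cs} → Comb G g v k lvl cs → ∃ λ c → c ∈ cs × spine c ≡ v × entry c ≡ g
  comb-head (end _ _)    = _ , here refl , refl , refl
  comb-head (more _ _ _) = _ , here refl , refl , refl

  comb-adj-entry : ∀ {g v k lvl cs c} → Comb G g v k lvl cs → c ∈ cs → adj G (spine c) (entry c) ≡ true
  comb-adj-entry (end e _)    (here refl) = e
  comb-adj-entry (more e _ _) (here refl) = e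
  comb-adj-entry (more _ _ k) (there c∈)  = comb-adj-entry k c∈

  comb-adj-tooth : ∀ {g v k lvl cs c} → Comb G g v k lvl cs → c ∈ cs → adj G (tooth c) (spine c) ≡ true
  comb-adj-tooth (end _ e)    (here refl) = e
  comb-adj-tooth (more _ e _) (here refl) = e
  comb-adj-tooth (more _ _ k) (there c∈)  = comb-adj-tooth k c∈

  comb-level : ∀ {g v k lvl cs c} → Comb G g v k lvl cs → c ∈ cs → level c < lvl + k
  comb-level {lvl = lvl} (end _ _)    (here refl) = m<m+n lvl z<s
  comb-level {lvl = lvl} (more _ _ _) (here refl) = m<m+n lvl z<s
  comb-level {k = suc k} {lvl} (more _ _ p) (there c∈) =
    ≤-trans (comb-level p c∈) (≤-reflexive (sym (+-suc lvl k)))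

  comb-kid : ∀ {g v k lvl cs c w} → Comb G g v k lvl cs → c ∈ cs → kid c ≡ just w →
    ∃ λ c′ → c′ ∈ cs × spine c′ ≡ w × entry c′ ≡ spine c
  comb-kid (more _ _ p) (here refl) refl = let c , c∈ , h = comb-head p in c , there c∈ , h
  comb-kid (more _ _ p) (there c∈)  eq   = let c , c∈ , h = comb-kid p c∈ eq in c , there c∈ , h

  comb-entry : ∀ {g v k lvl cs c} → Comb G g v k lvl cs → c ∈ cs →
    (entry c ≡ g × spine c ≡ v × level c ≡ lvl) ⊎
    ∃ λ c′ → c′ ∈ cs × spine c′ ≡ entry c × kid c′ ≡ just (spine c) × level c′ < level c
  comb-entry (end _ _)    (here refl) = inj₁ (refl , refl , refl)
  comb-entry (more _ _ _) (here refl) = inj₁ (refl , refl , refl)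
  comb-entry (more _ _ p) (there c∈) with comb-entry p c∈
  ... | inj₁ (refl , refl , refl) = inj₂ (_ , here refl , refl , refl , ≤-refl)
  ... | inj₂ (c′ , c′∈ , h)       = inj₂ (c′ , there c′∈ , h)

  comb-length : ∀ {g v k lvl cs} → Comb G g v k lvl cs → length cs ≡ k
  comb-length (end _ _)    = refl
  comb-length (more _ _ p) = cong suc (comb-length p)

  comb-kids : ∀ {g v k lvl cs} → Comb G g v k lvl cs → suc (length (filter hasKid? cs)) ≡ k
  comb-kids (end _ _)    = refl
  comb-kids (more _ _ p) = cong suc (comb-kids p)

  module _ {f : Fin n → Fin n} {L : ℕ} where

    packed-length : ∀ {t cells} → Packed G f L t cells → length cells ≡ L * t
    packed-length []                            = sym (*-zeroʳ L)
    packed-length (_∷_ {t = t} {cs = cs} p ps) = trans (length-++ cs)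
      (trans (cong₂ _+_ (comb-length p) (packed-length ps)) (sym (*-suc L t)))

    packed-kids : ∀ {t cells} → Packed G f L t cells → t + length (filter hasKid? cells) ≡ L * t
    packed-kids [] = sym (*-zeroʳ L)
    packed-kids (_∷_ {t = t} {cs = cs} {cells} p ps) = begin
      suc t + length (filter hasKid? (cs ++ cells))
        ≡⟨ cong (λ xs → suc t + length xs) (filter-++ hasKid? cs cells) ⟩
      suc t + length (filter hasKid? cs ++ filter hasKid? cells)
        ≡⟨ cong (suc t +_) (length-++ (filter hasKid? cs)) ⟩
      suc t + (length (filter hasKid? cs) + length (filter hasKid? cells))
        ≡⟨ lemma t (length (filter hasKid? cs)) (length (filter hasKid? cells)) ⟩
      suc (length (filter hasKid? cs)) + (t + length (filter hasKid? cells))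
        ≡⟨ cong₂ _+_ (comb-kids p) (packed-kids ps) ⟩
      L + L * t
        ≡⟨ sym (*-suc L t) ⟩
      L * suc t ∎
      where
      open ≡-Reasoning
      lemma : ∀ t a b → suc t + (a + b) ≡ suc a + (t + b)
      lemma = solve-∀

    packed-comb : ∀ {t cells c} → Packed G f L t cells → c ∈ cells →
      ∃₂ λ v cs → Comb G (f v) v L 0 cs × c ∈ cs × (∀ {c′} → c′ ∈ cs → c′ ∈ cells)
    packed-comb (_∷_ {cs = cs} p ps) c∈ with ∈-++⁻ cs c∈
    ... | inj₁ c∈cs = _ , cs , p , c∈cs , ∈-++⁺ˡ
    ... | inj₂ c∈ps with packed-comb ps c∈ps
    ...   | v , cs′ , q , c∈cs′ , sub = v , cs′ , q , c∈cs′ , ∈-++⁺ʳ cs ∘ sub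

module _ {n} {G : Graph n} {ρ : Fin n} where
  open DecMembership (_≟_ {n}) using (_∈?_)

  parOf : ∀ {W} → Grown G ρ W → Fin n → Fin n
  parOf seed _ = ρ
  parOf (grow {c} {p} _ _ _ g) u with u ≟ c
  ... | yes _ = p
  ... | no _  = parOf g u

  rankOf : ∀ {W} → Grown G ρ W → Fin n → ℕ
  rankOf seed _ = 0
  rankOf (grow {c} {W = W} _ _ _ g) u with u ≟ c
  ... | yes _ = length W
  ... | no _  = rankOf g u

  parOf-old : ∀ {c p W} {c∉ : c ∉ W} {p∈ : p ∈ W} {e : adj G c p ≡ true} {g : Grown G ρ W} {u} →
    u ∈ W → parOf (grow c∉ p∈ e g) u ≡ parOf g u
  parOf-old {c} {c∉ = c∉} {u = u} u∈ with u ≟ c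
  ... | yes refl = ⊥-elim (c∉ u∈)
  ... | no _     = refl

  parOf-new : ∀ {c p W} (c∉ : c ∉ W) (p∈ : p ∈ W) (e : adj G c p ≡ true) (g : Grown G ρ W) →
    parOf (grow c∉ p∈ e g) c ≡ p
  parOf-new {c} _ _ _ _ with c ≟ c
  ... | yes _  = refl
  ... | no c≢c = ⊥-elim (c≢c refl)

  rankOf-old : ∀ {c p W} {c∉ : c ∉ W} {p∈ : p ∈ W} {e : adj G c p ≡ true} {g : Grown G ρ W} {u} →
    u ∈ W → rankOf (grow c∉ p∈ e g) u ≡ rankOf g u
  rankOf-old {c} {c∉ = c∉} {u = u} u∈ with u ≟ c
  ... | yes refl = ⊥-elim (c∉ u∈)
  ... | no _     = refl

  parOf-root : ∀ {W} (g : Grown G ρ W) → parOf g ρ ≡ ρ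
  parOf-root seed              = refl
  parOf-root (grow c∉ p∈ e g) = trans (parOf-old {c∉ = c∉} {p∈} {e} (root∈ G g)) (parOf-root g)

  parOf-∈ : ∀ {W} (g : Grown G ρ W) u → parOf g u ∈ W
  parOf-∈ seed _ = here refl
  parOf-∈ (grow {c} _ p∈ _ g) u with u ≟ c
  ... | yes _ = there p∈
  ... | no _  = there (parOf-∈ g u)

  rankOf-< : ∀ {W} (g : Grown G ρ W) u → rankOf g u < length W
  rankOf-< seed _ = ≤-refl
  rankOf-< (grow {c} _ _ _ g) u with u ≟ c
  ... | yes _ = ≤-refl
  ... | no _  = m≤n⇒m≤1+n (rankOf-< g u)

  parOf-adj : ∀ {W} (g : Grown G ρ W) {u} → u ∈ W → u ≢ ρ → adj G u (parOf g u) ≡ true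
  parOf-adj seed (here refl) u≢ρ = ⊥-elim (u≢ρ refl)
  parOf-adj (grow {c} _ _ e g) {u} u∈ u≢ρ with u ≟ c | u∈
  ... | yes refl | _         = e
  ... | no u≢c   | here refl = ⊥-elim (u≢c refl)
  ... | no _     | there u∈W = parOf-adj g u∈W u≢ρ

  rankOf-par : ∀ {W} (g : Grown G ρ W) {u} → u ∈ W → u ≢ ρ → rankOf g (parOf g u) < rankOf g u
  rankOf-par seed (here refl) u≢ρ = ⊥-elim (u≢ρ refl)
  rankOf-par (grow {c} c∉ p∈ e g) {u} u∈ u≢ρ with u ≟ c | u∈
  ... | yes refl | _         = subst (_< _) (sym (rankOf-old {c∉ = c∉} {p∈} {e} p∈)) (rankOf-< g _)
  ... | no u≢c   | here refl = ⊥-elim (u≢c refl)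
  ... | no _     | there u∈W =
    subst (_< _) (sym (rankOf-old {c∉ = c∉} {p∈} {e} (parOf-∈ g u))) (rankOf-par g u∈W u≢ρ)

  module _ {W} (g : Grown G ρ W) (dom : Dominating G W) where

    base-parent : Fin n → Fin n
    base-parent u with u ∈? W
    ... | yes _ = parOf g u
    ... | no _  = proj₁ (find (dom u))

    base-parent-W : ∀ {u} → u ∈ W → base-parent u ≡ parOf g u
    base-parent-W {u} u∈ with u ∈? W
    ... | yes _ = refl
    ... | no u∉ = ⊥-elim (u∉ u∈)

    base-parent-∈ : ∀ u → base-parent u ∈ W
    base-parent-∈ u with u ∈? W
    ... | yes _ = parOf-∈ g u
    ... | no _  = proj₁ (proj₂ (find (dom u)))

    base-parent-adj : ∀ {u} → u ≢ ρ → adj G u (base-parent u) ≡ true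
    base-parent-adj {u} u≢ρ with u ∈? W
    ... | yes u∈ = parOf-adj g u∈ u≢ρ
    ... | no u∉ with find (dom u)
    ...   | w , w∈ , inj₁ refl = ⊥-elim (u∉ w∈)
    ...   | w , w∈ , inj₂ e    = trans (Graph.sym G u w) e

    module _ {L t cells} (packed : Packed G base-parent L t cells)
             (unique : Unique (vertices cells)) (outside : ∀ {v} → v ∈ vertices cells → v ∉ W) where

      scaffold : Scaffold G
      scaffold = record
        { root = ρ ; W = W ; par₀ = base-parent ; rank₀ = rankOf g ; B = length W ; L = L ; cells = cells
        ; root∈W = root∈ G g
        ; par₀-root = trans (base-parent-W (root∈ G g)) (parOf-root g)
        ; par₀-∈W = base-parent-∈
        ; par₀-adj = base-parent-adj
        ; rank₀-< = λ v∈ v≢ρ → subst (λ p → rankOf g p < _) (sym (base-parent-W v∈)) (rankOf-par g v∈ v≢ρ)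
        ; rank₀-<B = λ _ → rankOf-< g _
        ; cells-unique = cells-unique′ unique
        ; spine-injective = spine-inj unique
        ; tooth-injective = tooth-inj unique
        ; spine≢tooth = spine≢tooth′ unique
        ; spine∉W = outside ∘ spine∈
        ; tooth∉W = outside ∘ tooth∈
        ; adj-entry = λ c∈ → let _ , _ , p , c∈cs , _ = packed-comb packed c∈ in comb-adj-entry p c∈cs
        ; adj-tooth = λ c∈ → let _ , _ , p , c∈cs , _ = packed-comb packed c∈ in comb-adj-tooth p c∈cs
        ; level-<L = λ c∈ → let _ , _ , p , c∈cs , _ = packed-comb packed c∈ in comb-level p c∈cs
        ; entry-from = entry-from
        ; kid-cell = λ c∈ eq → let _ , _ , p , c∈cs , sub = packed-comb packed c∈
                                   c′ , c′∈ , h = comb-kid p c∈cs eq in c′ , sub c′∈ , h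
        }
        where
        entry-from : ∀ {c} → c ∈ cells → entry c ∈ W ⊎
          ∃ λ c′ → c′ ∈ cells × spine c′ ≡ entry c × kid c′ ≡ just (spine c) × level c′ < level c
        entry-from c∈ with packed-comb packed c∈
        ... | v , cs , p , c∈cs , sub with comb-entry p c∈cs
        ...   | inj₁ (refl , _)     = inj₁ (base-parent-∈ v)
        ...   | inj₂ (c′ , c′∈ , h) = inj₂ (c′ , sub c′∈ , h)

      -- Programs that name all spines and entries

      open Scaffold scaffold using (Plan; []; base; head; step)

      record PlanFor (k : ℕ) (T : Fin n → Set) : Set where
        field
          program : List (Instr n)
          plan    : Plan program
          frees   : #free program ≡ k
          known   : ∀ {v} → T v → Known ρ program v
      open PlanFor

      known-∷ : ∀ {is v} i → Known ρ is v → Known ρ (i ∷ is) v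
      known-∷ i (inj₁ eq) = inj₁ eq
      known-∷ i (inj₂ v∈) = inj₂ (there v∈)

      -- One free instruction for each vertex of W except the root. The recursion visits the earlier
      -- stages of the growth, and the last hypothesis says that later stages do not change the
      -- parents assigned there.
      planTree : ∀ {W₀} (g₀ : Grown G ρ W₀) → (∀ {v} → v ∈ W₀ → v ∈ W) →
        (∀ {v} → v ∈ W₀ → parOf g v ≡ parOf g₀ v) → PlanFor (length W₀ ∸ 1) (_∈ W₀)
      planTree seed _ _ = record
        { program = [] ; plan = [] ; frees = refl ; known = λ { (here eq) → inj₁ eq } }
      planTree (grow {c} {p} {W₀} c∉ p∈ e g₀) sub agree = record
        { program = free c (base-parent c) ∷ program P
        ; plan = base (sub (here refl)) c≢ρ (subst (Known ρ (program P)) (sym par≡p) (known P p∈)) (plan P)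
        ; frees = trans (cong suc (frees P)) (suc-∸1 (root∈ G g₀))
        ; known = λ { (here refl) → inj₂ (here refl) ; (there v∈) → known-∷ (free c (base-parent c)) (known P v∈) } }
        where
        P = planTree g₀ (sub ∘ there) λ v∈ → trans (agree (there v∈)) (parOf-old {c∉ = c∉} {p∈} {e} v∈)
        c≢ρ : c ≢ ρ
        c≢ρ eq = c∉ (subst (_∈ W₀) (sym eq) (root∈ G g₀))
        par≡p : base-parent c ≡ p
        par≡p = trans (base-parent-W (sub (here refl))) (trans (agree (here refl)) (parOf-new c∉ p∈ e g₀))
        suc-∸1 : ∀ {v} {V : List (Fin n)} → v ∈ V → suc (length V ∸ 1) ≡ length V
        suc-∸1 (here _)  = refl
        suc-∸1 (there _) = refl

      Extends : List (Instr n) → (ℕ → ℕ) → (Fin n → Set) → Set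
      Extends is k T = ∃ λ is′ → Plan is′ × #free is′ ≡ k (#free is) ×
        (∀ {v} → Known ρ is v → Known ρ is′ v) × (∀ {v} → T v → Known ρ is′ v)

      OnSpine : List (Cell n) → Fin n → Set
      OnSpine cs v = ∃ λ c → c ∈ cs × (v ≡ spine c ⊎ v ≡ entry c)

      -- Once the first spine vertex and its entry are known, every further spine vertex is forced.
      -- Hence the cost of a comb, a single free instruction spent by `planCombs`, does not grow
      -- with its length.
      planComb : ∀ {h v k lvl cs is} → Comb G h v k lvl cs → (∀ {c} → c ∈ cs → c ∈ cells) →
        Known ρ is h → Known ρ is v → Plan is → Extends is id (OnSpine cs)
      planComb (end _ _) sub kh kv plan = _ , plan , refl , id ,
        λ { (_ , here refl , inj₁ refl) → kv ; (_ , here refl , inj₂ refl) → kh }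
      planComb {h} {v} (more {v′ = v′} _ _ p) sub kh kv plan
        with planComb p (sub ∘ there) (known-∷ (forced v′ v h) kv) (inj₂ (here refl))
               (step (sub (here refl)) refl kv kh plan)
      ... | is′ , plan′ , frees′ , mono , covers = is′ , plan′ , frees′ , mono ∘ known-∷ (forced v′ v h) ,
        λ { (_ , here refl , inj₁ refl) → mono (known-∷ (forced v′ v h) kv)
          ; (_ , here refl , inj₂ refl) → mono (known-∷ (forced v′ v h) kh)
          ; (_ , there c∈ , eq)         → covers (_ , c∈ , eq) }

      planCombs : ∀ {t cs is} → Packed G base-parent L t cs → (∀ {c} → c ∈ cs → c ∈ cells) →
        (∀ {v} → v ∈ W → Known ρ is v) → Plan is → Extends is (t +_) (OnSpine cs)
      planCombs [] sub kW plan = _ , plan , refl , id , λ ()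
      planCombs {is = is} (_∷_ {v = v} {cs} p ps) sub kW plan
        with planComb p (sub ∘ ∈-++⁺ˡ) (known-∷ (free v (base-parent v)) (kW (base-parent-∈ v)))
               (inj₂ (here refl)) (start (comb-head p))
        where
        start : (∃ λ c → c ∈ cs × spine c ≡ v × entry c ≡ base-parent v) →
          Plan (free v (base-parent v) ∷ is)
        start (c , c∈ , refl , eq) = subst (λ q → Plan (free v q ∷ is)) eq
          (head (sub (∈-++⁺ˡ c∈)) (kW (subst (_∈ W) (sym eq) (base-parent-∈ v))) plan)
      ... | is₁ , plan₁ , frees₁ , mono₁ , covers₁
        with planCombs ps (sub ∘ ∈-++⁺ʳ cs) (mono₁ ∘ known-∷ (free v (base-parent v)) ∘ kW) plan₁
      ... | is₂ , plan₂ , frees₂ , mono₂ , covers₂ =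
        is₂ , plan₂ , trans frees₂ (trans (cong (_ +_) frees₁) (+-suc _ (#free is))) ,
        mono₂ ∘ mono₁ ∘ known-∷ (free v (base-parent v)) , covers
        where
        covers : ∀ {u} → OnSpine (cs ++ _) u → Known ρ is₂ u
        covers (c , c∈ , eq) with ∈-++⁻ cs c∈
        ... | inj₁ c∈cs = mono₂ (covers₁ (c , c∈cs , eq))
        ... | inj₂ c∈ps = covers₂ (c , c∈ps , eq)

      fullPlan : PlanFor (t + (length W ∸ 1)) (OnSpine cells)
      fullPlan with planTree g id (λ _ → refl)
      ... | P with planCombs packed id (known P) (plan P)
      ...   | is , plan′ , frees′ , _ , covers = record
        { program = is ; plan = plan′ ; frees = trans frees′ (cong (t +_) (frees P)) ; known = covers }

-- Parameters of the construction

Unique-↭ : ∀ {A : Set} {xs ys : List A} → xs ↭ ys → Unique xs → Unique ys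
Unique-↭ p = PermSetoid.Unique-resp-↭ (setoid _) (↭⇒↭ₛ p)

-- The parameters of the construction: a tree on w vertices, whose size is governed by a and b,
-- with t combs of L spine vertices.
record Harvest {n} (G : Graph n) (d q L : ℕ) : Set where
  field
    w a b t bits : ℕ
    w-bound : w ≤ 3 * (a + b) + 1
    a-bound : a * q ≤ n
    b-bound : b * d ≤ 2 * (n * q)
    t-bound : 2 * (L * t) ≤ n
    n-bound : n * d ≤ 5 * ((w + 2 * (L * t)) * d) + 8 * (L * n)
    bits-eq : t + bits ≡ L * t
    trees   : ∀ K → K * (n * (2 * d) ^ (t + (w ∸ 1))) ≤ 2 ^ bits → AtLeastUnlabeledSpanningTrees G K

harvest : ∀ {n} (G : Graph n) → Connected G → ∀ {d} → 0 < d →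
  (∀ v → d ≤ 2 * degree G v) → (∀ v → degree G v ≤ 2 * d) →
  Fin n → ∀ q l → Harvest G d q (suc l)
harvest {n} G conn {d} d>0 deg≥ deg≤ ρ q l = record
  { w = length W ; a = a ; b = b ; t = t
  ; w-bound = size ; a-bound = a-bound ; b-bound = b-bound
  ; t-bound = t-bound
  ; n-bound = n-bound
  ; bits-eq = packed-kids packed
  ; trees = λ K h → manyTrees S plan
      (λ c∈ → known (_ , c∈ , inj₁ refl)) (λ c∈ → known (_ , c∈ , inj₂ refl))
      deg≤
      (≤-trans (≤-reflexive (cong (λ k → K * (n * (2 * d) ^ k)) frees)) h)
      (subst (λ k → n * (2 * d) ^ k ≢ 0) (sym frees) positive) }
  where
  open DominatingTree (dominatingTree G conn deg≥ ρ q)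
  open DecMembership (_≟_ {n}) using (_∈?_)

  L : ℕ
  L = suc l

  V I U : List (Fin n)
  V = allVertices n
  I = filter (_∈? W) V
  U = filter (λ v → ¬? (v ∈? W)) V

  f : Fin n → Fin n
  f = base-parent grown dominating

  U-adj : ∀ {u} → u ∈ U → adj G u (f u) ≡ true
  U-adj u∈ = base-parent-adj grown dominating λ { refl →
    proj₂ (∈-filter⁻ (λ v → ¬? (v ∈? W)) {xs = V} u∈) (root∈ G grown) }

  open Packing (pack G f l _ U ≤-refl U-adj)

  C : List (Fin n)
  C = vertices cells

  unique : Unique C
  unique = Unique-++⁻ˡ C (Unique-↭ split (filter⁺ _ (allVertices-unique n)))

  outside : ∀ {v} → v ∈ C → v ∉ W
  outside v∈ = proj₂ (∈-filter⁻ (λ v → ¬? (v ∈? W)) {xs = V} (Perm.∈-resp-↭ (↭-sym split) (∈-++⁺ˡ v∈)))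

  S : Scaffold G
  S = scaffold grown dominating packed unique outside

  open PlanFor (fullPlan grown dominating packed unique outside)

  positive : n * (2 * d) ^ (t + (length W ∸ 1)) ≢ 0
  positive = ≢-nonZero⁻¹ _ {{m*n≢0 n _ {{Fin-nonZero ρ}} {{m^n≢0 (2 * d) (t + (length W ∸ 1)) {{m*n≢0 2 d {{_}} {{>-nonZero d>0}}}}}}}}
    where
    Fin-nonZero : ∀ {n} → Fin n → NonZero n
    Fin-nonZero zero    = _
    Fin-nonZero (suc _) = _

  C-length : length C ≡ 2 * (L * t)
  C-length = trans (length-vertices cells) (cong (2 *_) (packed-length packed))

  U-length : length U ≡ length C + length dead
  U-length = trans (Perm.↭-length split) (length-++ C)

  n-split : n ≡ length I + (length C + length dead)
  n-split = trans (sym (length-allVertices n))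
    (trans (length-filter-¬ (_∈? W) V) (cong (length I +_) U-length))

  t-bound : 2 * (L * t) ≤ n
  t-bound = begin
    2 * (L * t)                             ≡⟨ sym C-length ⟩
    length C                                ≤⟨ m≤m+n _ _ ⟩
    length C + length dead                  ≤⟨ m≤n+m _ (length I) ⟩
    length I + (length C + length dead)     ≡⟨ sym n-split ⟩
    n                                       ∎
    where open ≤-Reasoning

  I≤W : length I ≤ length W
  I≤W = Unique-⊆-length (filter⁺ _ (allVertices-unique n)) λ v∈ → proj₂ (∈-filter⁻ (_∈? W) {xs = V} v∈)

  degree-split : ∀ v → degree G v ≡ count G v I + (count G v C + count G v dead)
  degree-split v = trans (count-filter-¬ G (_∈? W) v V)
    (cong (count G v I +_) (trans (count-↭ G v split) (count-++ G v C dead)))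

  dead≤degree : ∀ v → count G v dead ≤ 2 * d
  dead≤degree v = ≤-trans (m≤n+m _ (count G v C)) (≤-trans (m≤n+m _ (count G v I))
    (≤-trans (≤-reflexive (sym (degree-split v))) (deg≤ v)))

  edges-split : ∀ D → edges G D V ≡ edges G D I + (edges G D C + edges G D dead)
  edges-split []      = refl
  edges-split (v ∷ D) = trans (cong₂ _+_ (degree-split v) (edges-split D))
    (lemma (count G v I) (count G v C) (count G v dead) (edges G D I) (edges G D C) (edges G D dead))
    where
    lemma : ∀ a b c x y z → (a + (b + c)) + (x + (y + z)) ≡ (a + x) + ((b + y) + (c + z))
    lemma = solve-∀

  to-dead : ∀ P → edges G dead P ≤ length P * (2 * d)
  to-dead P = ≤-trans (≤-reflexive (edges-comm G dead P)) (sum-map-≤ dead≤degree P)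

  -- Dead vertices have degree at least d/2 but few edges among themselves, and a vertex of W or of
  -- a comb receives at most 2d of their edges. For `L` small against d they can outnumber W and the
  -- combs by a constant factor at most.
  dead-bound : length dead * d ≤ 2 * (length I * (2 * d) + (length C * (2 * d) + 4 * L * length dead))
  dead-bound = ≤-trans (length*d≤edges G deg≥ dead) (*-monoʳ-≤ 2
    (≤-trans (≤-reflexive (edges-split dead)) (+-mono-≤ (to-dead I) (+-mono-≤ (to-dead C) sparse))))

  n-bound : n * d ≤ 5 * ((length W + 2 * (L * t)) * d) + 8 * (L * n)
  n-bound = begin
    n * d
      ≡⟨ cong (_* d) n-split ⟩
    (length I + (length C + length dead)) * d
      ≡⟨ lemma₁ (length I) (length C) (length dead) d ⟩
    (length I + length C) * d + length dead * d
      ≤⟨ +-monoʳ-≤ ((length I + length C) * d) dead-bound ⟩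
    (length I + length C) * d + 2 * (length I * (2 * d) + (length C * (2 * d) + 4 * L * length dead))
      ≡⟨ lemma₂ (length I) (length C) (length dead) d L ⟩
    5 * ((length I + length C) * d) + 8 * (L * length dead)
      ≤⟨ +-mono-≤ (*-monoʳ-≤ 5 (*-monoˡ-≤ d (+-mono-≤ I≤W (≤-reflexive C-length))))
                  (*-monoʳ-≤ 8 (*-monoʳ-≤ L dead≤n)) ⟩
    5 * ((length W + 2 * (L * t)) * d) + 8 * (L * n) ∎
    where
    open ≤-Reasoning
    dead≤n : length dead ≤ n
    dead≤n = ≤-trans (m≤n+m _ (length C)) (≤-trans (m≤n+m _ (length I)) (≤-reflexive (sym n-split)))
    lemma₁ : ∀ i c x d → (i + (c + x)) * d ≡ (i + c) * d + x * d
    lemma₁ = solve-∀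
    lemma₂ : ∀ i c x d L →
      (i + c) * d + 2 * (i * (2 * d) + (c * (2 * d) + 4 * L * x)) ≡ 5 * ((i + c) * d) + 8 * (L * x)
    lemma₂ = solve-∀

-- Arithmetic

floorLog₂ : ∀ d → 0 < d → ∃ λ κ → 2 ^ κ ≤ d × d < 2 ^ suc κ
floorLog₂ (suc zero)    _ = 0 , ≤-refl , ≤-refl
floorLog₂ (suc (suc d)) _ with floorLog₂ (suc d) z<s
... | κ , lo , hi with suc (suc d) <? 2 ^ suc κ
...   | yes lt = κ , m≤n⇒m≤1+n lo , lt
...   | no ≮   = suc κ , ≮⇒≥ ≮ , (begin-strict
  suc (suc d)      ≤⟨ hi ⟩
  2 ^ suc κ        <⟨ ^-monoʳ-< 2 ≤-refl (n<1+n (suc κ)) ⟩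
  2 ^ suc (suc κ)  ∎)
  where open ≤-Reasoning

square-step : ∀ {k} → 3 ≤ k → suc k * suc k ≤ 2 * (k * k)
square-step {k} 3≤k = begin
  suc k * suc k            ≡⟨ lemma₁ k ⟩
  k * k + (2 * k + 1)      ≤⟨ +-monoʳ-≤ (k * k) (+-monoʳ-≤ (2 * k) (≤-trans (s≤s z≤n) 3≤k)) ⟩
  k * k + (2 * k + k)      ≡⟨ cong (k * k +_) (lemma₂ k) ⟩
  k * k + 3 * k            ≤⟨ +-monoʳ-≤ (k * k) (*-monoˡ-≤ k 3≤k) ⟩
  k * k + k * k            ≡⟨ lemma₃ (k * k) ⟩
  2 * (k * k)              ∎
  where
  open ≤-Reasoning
  lemma₁ : ∀ k → suc k * suc k ≡ k * k + (2 * k + 1)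
  lemma₁ = solve-∀
  lemma₂ : ∀ k → 2 * k + k ≡ 3 * k
  lemma₂ = solve-∀
  lemma₃ : ∀ x → x + x ≡ 2 * x
  lemma₃ = solve-∀

square≤2^ : ∀ c {k₀ k} → 3 ≤ k₀ → c * (k₀ * k₀) ≤ 2 ^ k₀ → k₀ ≤′ k → c * (k * k) ≤ 2 ^ k
square≤2^ c 3≤k₀ h ≤′-refl = h
square≤2^ c {k = suc k} 3≤k₀ h (≤′-step k₀≤k) = begin
  c * (suc k * suc k)    ≤⟨ *-monoʳ-≤ c (square-step (≤-trans 3≤k₀ (≤′⇒≤ k₀≤k))) ⟩
  c * (2 * (k * k))      ≡⟨ lemma c (k * k) ⟩
  2 * (c * (k * k))      ≤⟨ *-monoʳ-≤ 2 (square≤2^ c 3≤k₀ h k₀≤k) ⟩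
  2 ^ suc k              ∎
  where
  open ≤-Reasoning
  lemma : ∀ c x → c * (2 * x) ≡ 2 * (c * x)
  lemma = solve-∀

linear≤2^ : ∀ c {k₀ k} → 1 ≤ k₀ → c * k₀ ≤ 2 ^ k₀ → k₀ ≤′ k → c * k ≤ 2 ^ k
linear≤2^ c 1≤k₀ h ≤′-refl = h
linear≤2^ c {k = suc k} 1≤k₀ h (≤′-step k₀≤k) = begin
  c * suc k      ≤⟨ *-monoʳ-≤ c (+-monoˡ-≤ k (≤-trans 1≤k₀ (≤′⇒≤ k₀≤k))) ⟩
  c * (k + k)    ≡⟨ lemma c k ⟩
  2 * (c * k)    ≤⟨ *-monoʳ-≤ 2 (linear≤2^ c 1≤k₀ h k₀≤k) ⟩
  2 ^ suc k      ∎
  where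
  open ≤-Reasoning
  lemma : ∀ c k → c * (k + k) ≡ 2 * (c * k)
  lemma = solve-∀

4^≤ : ∀ c n m → n ≤ c * m → 4 ^ n ≤ (2 ^ m) ^ (2 * c)
4^≤ c n m n≤cm = begin
  4 ^ n                ≡⟨ ^-*-assoc 2 2 n ⟩
  2 ^ (2 * n)          ≤⟨ ^-monoʳ-≤ 2 (*-monoʳ-≤ 2 n≤cm) ⟩
  2 ^ (2 * (c * m))    ≡⟨ cong (2 ^_) (lemma c m) ⟩
  2 ^ (m * (2 * c))    ≡⟨ sym (^-*-assoc 2 m (2 * c)) ⟩
  (2 ^ m) ^ (2 * c)    ∎
  where
  open ≤-Reasoning
  lemma : ∀ c m → 2 * (c * m) ≡ m * (2 * c)
  lemma = solve-∀

-- Applied to closed a and b with proof refl, this avoids the unary comparison of a * x with b * x.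
rescale : ∀ a b → a ≡ b → ∀ x → a * x ≡ b * x
rescale a b eq x = cong (_* x) eq

-- With L = 20000 κ and L² ≤ d, the logarithmic cost (κ + 2)(t + w − 1) + 2m of naming a member of an
-- isomorphism class is far below the number n / 25 of free bits.
module Budget
  (n d κ L w a b t bits : ℕ)
  (L≡   : L ≡ 10 * (2000 * κ))
  (κ≥2  : 2 ≤ κ)
  (L²≤d : L * L ≤ d)
  (d≤2n : d ≤ 2 * n)
  (w-bound : w ≤ 3 * (a + b) + 1)
  (a-bound : a * L ≤ n)
  (b-bound : b * d ≤ 2 * (n * L))
  (t-bound : 2 * (L * t) ≤ n)
  (n-bound : n * d ≤ 5 * ((w + 2 * (L * t)) * d) + 8 * (L * n))
  (bits-eq : t + bits ≡ L * t)
  where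

  open ≤-Reasoning

  L≥40000 : 40000 ≤ L
  L≥40000 = begin
    10 * (2000 * 2)  ≤⟨ *-monoʳ-≤ 10 (*-monoʳ-≤ 2000 κ≥2) ⟩
    10 * (2000 * κ)  ≡⟨ sym L≡ ⟩
    L                ∎

  instance
    L≢0 : NonZero L
    L≢0 = >-nonZero (≤-trans (≤ᵇ⇒≤ 1 40000 _) L≥40000)

    d≢0 : NonZero d
    d≢0 = >-nonZero (≤-trans (*-mono-≤ {1} {L} {1} (>-nonZero⁻¹ L) (>-nonZero⁻¹ L)) L²≤d)

  n≥L : L ≤ n
  n≥L = *-cancelˡ-≤ 2 (begin
    2 * L    ≤⟨ *-monoˡ-≤ L (≤-trans (≤ᵇ⇒≤ 2 40000 _) L≥40000) ⟩
    L * L    ≤⟨ L²≤d ⟩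
    d        ≤⟨ d≤2n ⟩
    2 * n    ∎)

  n≥40000 : 40000 ≤ n
  n≥40000 = ≤-trans L≥40000 n≥L

  Lb≤2n : L * b ≤ 2 * n
  Lb≤2n = *-cancelʳ-≤ (L * b) (2 * n) L (begin
    L * b * L     ≡⟨ lemma L b ⟩
    b * (L * L)   ≤⟨ *-monoʳ-≤ b L²≤d ⟩
    b * d         ≤⟨ b-bound ⟩
    2 * (n * L)   ≡⟨ sym (*-assoc 2 n L) ⟩
    2 * n * L     ∎)
    where
    lemma : ∀ L b → L * b * L ≡ b * (L * L)
    lemma = solve-∀

  La≤n : L * a ≤ n
  La≤n = subst (_≤ n) (*-comm a L) a-bound

  Lt≤n : L * t ≤ n
  Lt≤n = ≤-trans (m≤m+n (L * t) _) t-bound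

  frees : ℕ
  frees = t + (w ∸ 1)

  frees≤ : frees ≤ t + 3 * (a + b)
  frees≤ = +-monoʳ-≤ t (≤-trans (∸-monoˡ-≤ 1 w-bound) (≤-reflexive (m+n∸n≡m (3 * (a + b)) 1)))

  L*frees≤10n : L * frees ≤ 10 * n
  L*frees≤10n = begin
    L * frees                       ≤⟨ *-monoʳ-≤ L frees≤ ⟩
    L * (t + 3 * (a + b))           ≡⟨ lemma₁ L t a b ⟩
    L * t + 3 * (L * a + L * b)     ≤⟨ +-mono-≤ Lt≤n (*-monoʳ-≤ 3 (+-mono-≤ La≤n Lb≤2n)) ⟩
    n + 3 * (n + 2 * n)             ≡⟨ lemma₂ n ⟩
    10 * n                          ∎
    where
    lemma₁ : ∀ L t a b → L * (t + 3 * (a + b)) ≡ L * t + 3 * (L * a + L * b)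
    lemma₁ = solve-∀
    lemma₂ : ∀ n → n + 3 * (n + 2 * n) ≡ 10 * n
    lemma₂ = solve-∀

  -- A free instruction chooses among at most 2d < 2^(κ + 2) neighbours and so costs 2 + κ ≤ 2κ
  -- bits. There are at most 10 n / L of them, and L = 20000 κ is chosen to make the total n / 1000.
  free-cost : 1000 * ((2 + κ) * frees) ≤ n
  free-cost = begin
    1000 * ((2 + κ) * frees)    ≤⟨ *-monoʳ-≤ 1000 (*-monoˡ-≤ frees (+-monoˡ-≤ κ κ≥2)) ⟩
    1000 * ((κ + κ) * frees)    ≡⟨ lemma 1000 κ frees ⟩
    1000 * 2 * κ * frees        ≡⟨ cong (_* frees) (rescale (1000 * 2) 2000 refl κ) ⟩
    2000 * κ * frees            ≤⟨ *-cancelˡ-≤ 10 (≤-trans (≤-reflexive regroup) L*frees≤10n) ⟩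
    n                           ∎
    where
    lemma : ∀ c k f → c * ((k + k) * f) ≡ c * 2 * k * f
    lemma = solve-∀
    regroup : 10 * (2000 * κ * frees) ≡ L * frees
    regroup = trans (sym (*-assoc 10 (2000 * κ) frees)) (cong (_* frees) (sym L≡))

  w-small : 100 * w ≤ n
  w-small = *-cancelˡ-≤ L (begin
    L * (100 * w)                       ≡⟨ lemma₁ L 100 w ⟩
    100 * (L * w)                       ≤⟨ *-monoʳ-≤ 100 (*-monoʳ-≤ L w-bound) ⟩
    100 * (L * (3 * (a + b) + 1))       ≡⟨ cong (100 *_) (lemma₂ L a b) ⟩
    100 * (3 * (L * a + L * b) + L)     ≤⟨ *-monoʳ-≤ 100 (+-mono-≤ (*-monoʳ-≤ 3 (+-mono-≤ La≤n Lb≤2n)) n≥L) ⟩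
    100 * (3 * (n + 2 * n) + n)         ≡⟨ cong (100 *_) (lemma₃ n) ⟩
    100 * (10 * n)                      ≡⟨ sym (*-assoc 100 10 n) ⟩
    100 * 10 * n                        ≤⟨ *-monoˡ-≤ n (≤-trans (≤ᵇ⇒≤ (100 * 10) 40000 _) L≥40000) ⟩
    L * n                               ∎)
    where
    lemma₁ : ∀ L c w → L * (c * w) ≡ c * (L * w)
    lemma₁ = solve-∀
    lemma₂ : ∀ L a b → L * (3 * (a + b) + 1) ≡ 3 * (L * a + L * b) + L
    lemma₂ = solve-∀
    lemma₃ : ∀ n → 3 * (n + 2 * n) + n ≡ 10 * n
    lemma₃ = solve-∀

  -- The error term 8 L n of `n-bound` is at most n d / 100, because 800 L ≤ L² ≤ d.
  n≤5w+10Lt : 100 * n ≤ 100 * (5 * (w + 2 * (L * t))) + n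
  n≤5w+10Lt = *-cancelʳ-≤ (100 * n) _ d (begin
    100 * n * d                                           ≡⟨ *-assoc 100 n d ⟩
    100 * (n * d)                                         ≤⟨ *-monoʳ-≤ 100 n-bound ⟩
    100 * (5 * ((w + 2 * (L * t)) * d) + 8 * (L * n))     ≡⟨ lemma 100 (w + 2 * (L * t)) d L n ⟩
    100 * (5 * (w + 2 * (L * t))) * d + n * (100 * 8 * L) ≤⟨ +-monoʳ-≤ (100 * (5 * (w + 2 * (L * t))) * d) (*-monoʳ-≤ n 800L≤d) ⟩
    100 * (5 * (w + 2 * (L * t))) * d + n * d             ≡⟨ sym (*-distribʳ-+ d (100 * (5 * (w + 2 * (L * t)))) n) ⟩
    (100 * (5 * (w + 2 * (L * t))) + n) * d               ∎)
    where
    800L≤d : 100 * 8 * L ≤ d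
    800L≤d = ≤-trans (*-monoˡ-≤ L (≤-trans (≤ᵇ⇒≤ (100 * 8) 40000 _) L≥40000)) L²≤d
    lemma : ∀ c x d L n → c * (5 * (x * d) + 8 * (L * n)) ≡ c * (5 * x) * d + n * (c * 8 * L)
    lemma = solve-∀

  Lt≤2bits : L * t ≤ 2 * bits
  Lt≤2bits = +-cancelˡ-≤ (2 * t) (L * t) (2 * bits) (begin
    2 * t + L * t       ≤⟨ +-monoˡ-≤ (L * t) (*-monoˡ-≤ t (≤-trans (≤ᵇ⇒≤ 2 40000 _) L≥40000)) ⟩
    L * t + L * t       ≡⟨ cong₂ _+_ (sym bits-eq) (sym bits-eq) ⟩
    (t + bits) + (t + bits)  ≡⟨ lemma t bits ⟩
    2 * t + 2 * bits    ∎)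
    where
    lemma : ∀ t b → (t + b) + (t + b) ≡ 2 * t + 2 * b
    lemma = solve-∀

  -- With 100 w ≤ n and L t ≤ 2 bits the previous bound gives 94 n ≤ 2000 bits; 94 is lowered to 80
  -- for an integral quotient.
  n≤25bits : n ≤ 25 * bits
  n≤25bits = *-cancelˡ-≤ 80 (+-cancelʳ-≤ (20 * n) (80 * n) (80 * (25 * bits)) (begin
    80 * n + 20 * n                                  ≡⟨ sym (*-distribʳ-+ n 80 20) ⟩
    (80 + 20) * n                                    ≡⟨ rescale (80 + 20) 100 refl n ⟩
    100 * n                                          ≤⟨ n≤5w+10Lt ⟩
    100 * (5 * (w + 2 * (L * t))) + n                ≡⟨ lemma₁ 100 w (L * t) n ⟩
    5 * (100 * w) + 100 * 10 * (L * t) + n           ≤⟨ +-monoˡ-≤ n (+-mono-≤ (*-monoʳ-≤ 5 w-small) (*-monoʳ-≤ (100 * 10) Lt≤2bits)) ⟩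
    5 * n + 100 * 10 * (2 * bits) + n                ≡⟨ lemma₂ (100 * 10) n bits ⟩
    100 * 10 * 2 * bits + 6 * n                      ≡⟨ cong (_+ 6 * n) (rescale (100 * 10 * 2) (80 * 25) refl bits) ⟩
    80 * 25 * bits + 6 * n                           ≡⟨ cong (_+ 6 * n) (*-assoc 80 25 bits) ⟩
    80 * (25 * bits) + 6 * n                         ≤⟨ +-monoʳ-≤ (80 * (25 * bits)) (*-monoˡ-≤ n (≤ᵇ⇒≤ 6 20 _)) ⟩
    80 * (25 * bits) + 20 * n                        ∎))
    where
    lemma₁ : ∀ c w x n → c * (5 * (w + 2 * x)) + n ≡ 5 * (c * w) + c * 10 * x + n
    lemma₁ = solve-∀
    lemma₂ : ∀ q n b → 5 * n + q * (2 * b) + n ≡ q * 2 * b + 6 * n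
    lemma₂ = solve-∀

  -- Rounded up, so that (2^m)^2000 ≥ 4^n. It also satisfies n ≤ 2^m, so guessing the image of the
  -- root costs at most m further bits.
  m : ℕ
  m = suc (n / 1000)

  n≤1000m : n ≤ 1000 * m
  n≤1000m = begin
    n                              ≡⟨ m≡m%n+[m/n]*n n 1000 ⟩
    n % 1000 + n / 1000 * 1000     ≤⟨ +-monoˡ-≤ (n / 1000 * 1000) (<⇒≤ (m%n<n n 1000)) ⟩
    m * 1000                       ≡⟨ *-comm m 1000 ⟩
    1000 * m                       ∎

  1000m≤2n : 1000 * m ≤ 2 * n
  1000m≤2n = begin
    1000 * m                   ≡⟨ *-suc 1000 (n / 1000) ⟩
    1000 + 1000 * (n / 1000)   ≡⟨ cong (1000 +_) (*-comm 1000 (n / 1000)) ⟩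
    1000 + n / 1000 * 1000     ≤⟨ +-mono-≤ (≤-trans (≤ᵇ⇒≤ 1000 40000 _) n≥40000) (≤-trans (m≤n+m _ (n % 1000)) (≤-reflexive (sym (m≡m%n+[m/n]*n n 1000)))) ⟩
    n + n                      ≡⟨ cong (n +_) (sym (+-identityʳ n)) ⟩
    2 * n                      ∎

  m≥40 : 40 ≤ m
  m≥40 = *-cancelˡ-≤ 1000 (≤-trans n≥40000 n≤1000m)

  n≤2^m : n ≤ 2 ^ m
  n≤2^m = ≤-trans n≤1000m (linear≤2^ 1000 {40} (≤ᵇ⇒≤ 1 40 _) (≤ᵇ⇒≤ 40000 (2 ^ 40) _) (≤⇒≤′ m≥40))

  -- One m pays for the number of trees, the other for the image of the root, and the rest for the
  -- free instructions. Together they are at most n / 200, against at least n / 25 bits.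
  exponent≤bits : m + (m + (2 + κ) * frees) ≤ bits
  exponent≤bits = *-cancelˡ-≤ 1000 (begin
    1000 * (m + (m + (2 + κ) * frees))                   ≡⟨ lemma₁ 1000 m ((2 + κ) * frees) ⟩
    1000 * m + 1000 * m + 1000 * ((2 + κ) * frees)       ≤⟨ +-mono-≤ (+-mono-≤ 1000m≤2n 1000m≤2n) free-cost ⟩
    2 * n + 2 * n + n                                    ≡⟨ lemma₂ n ⟩
    5 * n                                                ≤⟨ *-monoʳ-≤ 5 n≤25bits ⟩
    5 * (25 * bits)                                      ≡⟨ sym (*-assoc 5 25 bits) ⟩
    125 * bits                                           ≤⟨ *-monoˡ-≤ bits (≤ᵇ⇒≤ 125 1000 _) ⟩
    1000 * bits                                          ∎)
    where
    lemma₁ : ∀ c m x → c * (m + (m + x)) ≡ c * m + c * m + c * x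
    lemma₁ = solve-∀
    lemma₂ : ∀ n → 2 * n + 2 * n + n ≡ 5 * n
    lemma₂ = solve-∀

  budget : d < 2 ^ suc κ → 2 ^ m * (n * (2 * d) ^ frees) ≤ 2 ^ bits
  budget d< = begin
    2 ^ m * (n * (2 * d) ^ frees)
      ≤⟨ *-monoʳ-≤ (2 ^ m) (*-mono-≤ n≤2^m (^-monoˡ-≤ frees (*-monoʳ-≤ 2 (<⇒≤ d<)))) ⟩
    2 ^ m * (2 ^ m * (2 ^ (2 + κ)) ^ frees)
      ≡⟨ cong (λ z → 2 ^ m * (2 ^ m * z)) (^-*-assoc 2 (2 + κ) frees) ⟩
    2 ^ m * (2 ^ m * 2 ^ ((2 + κ) * frees))
      ≡⟨ cong (2 ^ m *_) (sym (^-distribˡ-+-* 2 m ((2 + κ) * frees))) ⟩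
    2 ^ m * 2 ^ (m + (2 + κ) * frees)
      ≡⟨ sym (^-distribˡ-+-* 2 m (m + (2 + κ) * frees)) ⟩
    2 ^ (m + (m + (2 + κ) * frees))
      ≤⟨ ^-monoʳ-≤ 2 exponent≤bits ⟩
    2 ^ bits ∎

  4^n≤ : 4 ^ n ≤ (2 ^ m) ^ 2000
  4^n≤ = ≤-trans (4^≤ 1000 n m n≤1000m) (≤-reflexive (cong ((2 ^ m) ^_) {2 * 1000} {2000} refl))

-- From the degree interval to the theorem

module _ {d k : ℕ} (D : ℕ) (2≤D : 2 ≤ D) where

  private
    instance
      D≢0 : NonZero D
      D≢0 = >-nonZero (≤-trans (s≤s z≤n) 2≤D)

  degree-lower : (D ∸ 1) * d ≤ D * k → d ≤ 2 * k
  degree-lower h = *-cancelˡ-≤ D (begin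
    D * d                ≤⟨ *-monoˡ-≤ d D≤ ⟩
    2 * (D ∸ 1) * d      ≡⟨ *-assoc 2 (D ∸ 1) d ⟩
    2 * ((D ∸ 1) * d)    ≤⟨ *-monoʳ-≤ 2 h ⟩
    2 * (D * k)          ≡⟨ lemma D k ⟩
    D * (2 * k)          ∎)
    where
    open ≤-Reasoning
    lemma : ∀ D k → 2 * (D * k) ≡ D * (2 * k)
    lemma = solve-∀
    D≤ : D ≤ 2 * (D ∸ 1)
    D≤ = begin
      D                        ≡⟨ sym (m+[n∸m]≡n (≤-trans (s≤s z≤n) 2≤D)) ⟩
      1 + (D ∸ 1)              ≤⟨ +-monoˡ-≤ (D ∸ 1) (∸-monoˡ-≤ 1 2≤D) ⟩
      (D ∸ 1) + (D ∸ 1)        ≡⟨ cong (D ∸ 1 +_) (sym (+-identityʳ (D ∸ 1))) ⟩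
      2 * (D ∸ 1)              ∎

  degree-upper : D * k ≤ (D + 1) * d → k ≤ 2 * d
  degree-upper h = *-cancelˡ-≤ D (begin
    D * k          ≤⟨ h ⟩
    (D + 1) * d    ≤⟨ *-monoˡ-≤ d (+-monoʳ-≤ D (≤-trans (s≤s z≤n) 2≤D)) ⟩
    (D + D) * d    ≡⟨ lemma D d ⟩
    D * (2 * d)    ∎)
    where
    open ≤-Reasoning
    lemma : ∀ D d → (D + D) * d ≡ D * (2 * d)
    lemma = solve-∀

emptyGraphCase : (G : Graph 0) → AtLeastUnlabeledSpanningTrees G 1
emptyGraphCase G = G ∷ [] , refl , spanning , All.[] ∷ []
  where
  spanning : ∀ {H} → H ∈ G ∷ [] → IsSpanningTree G H
  spanning (here refl) = (λ _ _ e → e) , (λ ()) , λ (_ , c , _) → case c zero of λ ()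

module _ {n : ℕ} (G : Graph n) (v : Fin n) (conn : Connected G) {d : ℕ} (d≥ : 2 ^ 64 ≤ d)
         (deg≥ : ∀ v → d ≤ 2 * degree G v) (deg≤ : ∀ v → degree G v ≤ 2 * d) where

  exponentiallyManyTrees : ∃ λ K → 4 ^ n ≤ K ^ 2000 × AtLeastUnlabeledSpanningTrees G K
  exponentiallyManyTrees with floorLog₂ d (≤-trans (m^n>0 2 64) d≥)
  ... | κ , lo , hi = 2 ^ m , 4^n≤ , trees (2 ^ m) (budget hi)
    where
    L : ℕ
    L = 10 * (2000 * κ)

    κ≥64 : 64 ≤ κ
    κ≥64 = s≤s⁻¹ (≰⇒> λ κ<64 → <⇒≱ hi (≤-trans (^-monoʳ-≤ 2 κ<64) d≥))

    instance
      L≢0 : NonZero L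
      L≢0 = m*n≢0 10 (2000 * κ) {{_}} {{m*n≢0 2000 κ {{_}} {{>-nonZero (≤-trans (s≤s z≤n) κ≥64)}}}}

    -- The threshold 2^64 on d is made for this: 20000² κ² ≤ 2^κ is checked at κ = 64 and persists
    -- for larger κ.
    L²≤d : L * L ≤ d
    L²≤d = begin
      L * L                      ≡⟨ lemma 10 2000 κ ⟩
      20000 * 20000 * (κ * κ)    ≤⟨ square≤2^ (20000 * 20000) {64} (≤ᵇ⇒≤ 3 64 _) (≤ᵇ⇒≤ (20000 * 20000 * (64 * 64)) (2 ^ 64) _) (≤⇒≤′ κ≥64) ⟩
      2 ^ κ                      ≤⟨ lo ⟩
      d                          ∎
      where
      open ≤-Reasoning
      lemma : ∀ a b k → a * (b * k) * (a * (b * k)) ≡ (a * b) * (a * b) * (k * k)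
      lemma = solve-∀

    -- The covering threshold q is taken equal to `L`: then `a` ≤ n / L, and L² ≤ d gives `b` ≤ 2 n
    -- / L.
    open Harvest (subst (Harvest G d L) (suc-pred L)
      (harvest G conn (≤-trans (m^n>0 2 64) d≥) deg≥ deg≤ v L (pred L)))

    open Budget n d κ L w a b t bits refl (≤-trans (≤ᵇ⇒≤ 2 64 _) κ≥64) L²≤d
      (≤-trans (deg≥ v) (*-monoʳ-≤ 2 (degree≤n G v)))
      w-bound a-bound b-bound t-bound n-bound bits-eq

theorem1p4 : Σ ℕ λ d₀ → (0 < d₀) × (∀ d → d₀ ≤ d → ∀ n (G : Graph n) → Connected G → AlmostRegular d G → Σ ℕ λ K → ExpLe n (K ^ 2000) × AtLeastUnlabeledSpanningTrees G K)
theorem1p4 = 2 ^ 64 , m^n>0 2 64 , trees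
  where
  2≤δ⁻¹ : 2 ≤ δ⁻¹
  2≤δ⁻¹ = ≤ᵇ⇒≤ 2 δ⁻¹ _

  trees : ∀ d → 2 ^ 64 ≤ d → ∀ n (G : Graph n) → Connected G → AlmostRegular d G →
    Σ ℕ λ K → ExpLe n (K ^ 2000) × AtLeastUnlabeledSpanningTrees G K
  -- The empty graph meets the hypotheses for every d and offers no root for the construction; being
  -- its own spanning tree, it gives K = 1 = e^0.
  trees d d≥ zero    G conn reg = 1 , ExpLe-4^ 0 , emptyGraphCase G
  trees d d≥ (suc n) G conn reg = conclude (exponentiallyManyTrees G zero conn d≥
    (λ v → degree-lower {d} {degree G v} δ⁻¹ 2≤δ⁻¹ (proj₁ (reg v)))
    (λ v → degree-upper {d} {degree G v} δ⁻¹ 2≤δ⁻¹ (proj₂ (reg v))))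
    where
    conclude : (∃ λ K → 4 ^ suc n ≤ K ^ 2000 × AtLeastUnlabeledSpanningTrees G K) →
      Σ ℕ λ K → ExpLe (suc n) (K ^ 2000) × AtLeastUnlabeledSpanningTrees G K
    conclude (K , 4^n≤ , atLeast) =
      K , (λ m → ≤-trans (ExpLe-4^ (suc n) m) (*-monoˡ-≤ (m !) 4^n≤)) , atLeast
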